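{- Let $S$ be a finite set of positive integers with largest element $k$, and suppose the smallest positive integer not in $S$ is $k-c$ for some integer $c>0$. Let $(a_n)_{n\ge1}$ be the $S$-LID sequence. Suppose there exists an integer $d>0$ such that: (i) $k\ge 2d-4c+2$; (ii) for every integer $n$ with $c+d+1\le n\le k+c+1+d$, $a_{n+1}+a_n > a_{n+c}+a_{n-d}$; (iii) for every integer $n$ with $k+c+1\le n\le 2k+c+d+2$, \[ a_n+a_{n-k} > \sum_{\substack{i\ge0\\ i(k-c)<n-1}} a_{n-1-i(k-c)}. \] Then $a_{n+1}=a_n+a_{n-k}$ for all integers $n>k+c$.
   Context: For a set $S$ of positive integers, the $S$-legal index difference ($S$-LID) sequence $(a_n)_{n\ge 1}$ is defined recursively: for each positive integer $n$, $a_n$ is the smallest positive integer that cannot be written as $\sum_{\ell\in L} a_\ell$ for some set $L \subseteq \{1,\dots,n-1\}$ such that $|i-j|\notin S$ for all $i,j\in L$ (the empty sum is $0$). -}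

module Defs where

open import Data.Nat using (ℕ; _+_; _*_; _∸_; _≤_; _<_; _<?_; ∣_-_∣)
open import Data.List using (List; map; filter; upTo)
open import Data.Nat.ListAction using (sum)
open import Data.List.Membership.Propositional using (_∈_; _∉_)
open import Data.List.Relation.Unary.All using (All)
open import Data.List.Relation.Unary.Unique.Propositional using (Unique)
open import Data.Product using (Σ; _×_)
open import Relation.Binary.PropositionalEquality using (_≡_)
open import Relation.Nullary using (¬_)

-- Sequences are functions ℕ → ℕ indexed from 1 (the value at 0 is irrelevant).
-- A finite set S of positive integers is a list of naturals (membership via _∈_).

LegalIndexSet : List ℕ → ℕ → List ℕ → Set
LegalIndexSet S n L =
  All (λ i → 1 ≤ i × i < n) L × Unique L ×
  (∀ i j → i ∈ L → j ∈ L → ∣ i - j ∣ ∉ S)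

Representable : List ℕ → (ℕ → ℕ) → ℕ → ℕ → Set
Representable S a n m =
  Σ (List ℕ) λ L → LegalIndexSet S n L × sum (map a L) ≡ m

IsLID : List ℕ → (ℕ → ℕ) → Set
IsLID S a = ∀ n → 1 ≤ n →
  (1 ≤ a n) × ¬ Representable S a n (a n) ×
  (∀ m → 1 ≤ m → m < a n → Representable S a n m)

tailSum : (ℕ → ℕ) → ℕ → ℕ → ℕ
tailSum a step n =
  sum (map (λ i → a (n ∸ 1 ∸ i * step))
           (filter (λ i → i * step <? n ∸ 1) (upTo n)))

{-# OPTIONS --safe #-}

-- Write g = k - c, so that 1, ..., g - 1 lie in S while g does not, and let Θ N = a N + Θ (N - g)
-- be the largest sum that indices at most N with pairwise distances at least g could have.  A legal
-- representation of a n + a (n - k) by indices at most n cannot use n, so the recurrence holds at n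
-- as soon as Θ (n - 1) < a n + a (n - k); hypothesis (iii) gives this for small n.
--
-- For the other n, unfold Θ twice.  With j = n - k - 1 the inequality follows from the one at a
-- smaller n together with a (j + c) + a (j - δ) ≤ a j + a (j + 1), provided that δ + c + 2 ≤ g.  The
-- latter inequality is linear in a, hence propagates along the recurrence from a window of length
-- k + 1.
--
-- If d + c + 2 ≤ g, take δ = d and the window of hypothesis (ii).  Otherwise hypothesis (i) forces
-- g ≤ 7 c, and one takes δ = g - c - 2 and the first window on which (iii) is not assumed.  By (iii),
-- 2 c ≤ g and c² = O (g), so c ≤ 22 and only finitely many pairs (c, g) are left.  For each of them
-- either explicit bounds on a (g + 1), ..., a (g + c) contradict (iii) or give the window, or the same
-- is checked for the initial terms of every sequence arising from a choice of S ∩ {g + 1, ..., k - 1}.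
module Submission where

open import Defs
open import Algebra.Properties.CommutativeSemigroup using (interchange; x∙yz≈y∙xz)
open import Data.Bool using (Bool; true; false; _∧_; _∨_; not; T; if_then_else_)
open import Data.Empty using (⊥; ⊥-elim)
open import Data.List using (List; []; _∷_; map; filter; drop; applyUpTo; applyDownFrom)
open import Data.List.Membership.Propositional using (_∈_; _∉_)
open import Data.List.Properties using (filter-accept; filter-reject)
open import Data.List.Relation.Unary.All as All using (All; []; _∷_)
open import Data.List.Relation.Unary.AllPairs using ([]; _∷_)
open import Data.List.Relation.Unary.Any using (here; there)
open import Data.List.Relation.Unary.Unique.Propositional using (Unique)
open import Data.Nat using (ℕ; zero; suc; _+_; _*_; _∸_; _⊓_; _≤_; _<_; _>_; z≤n; s≤s; s≤s⁻¹; _<?_; _≤?_; _≤ᵇ_; _<ᵇ_; _≡ᵇ_; ∣_-_∣)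
open import Data.Nat.Induction using (<-rec)
open import Data.Nat.ListAction using (sum)
open import Data.Nat.Properties
open import Data.Nat.Solver using (module +-*-Solver)
open import Data.Product using (Σ; _×_; _,_; proj₁; proj₂)
open import Data.Sum using (_⊎_; inj₁; inj₂)
open import Data.Unit using (tt)
open import Function using (_∘_; id)
open import Relation.Binary.Definitions using (tri<; tri≈; tri>)
open import Relation.Binary.PropositionalEquality using (_≡_; refl; sym; trans; cong; cong₂; subst; subst₂; module ≡-Reasoning)
open import Relation.Nullary using (¬_; yes; no)
open import Data.List.Membership.DecPropositional _≟_ using (_∈?_)
open +-*-Solver using (solve; _:+_; _:*_; _:=_; con)

-- Progression sums with step `g`, and their agreement with `tailSum`.

module Ladder (a : ℕ → ℕ) (g : ℕ) (0<g : 0 < g) where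

  descend : ∀ N → suc N ∸ g ≤ N
  descend N = ∸-monoʳ-≤ (suc N) 0<g

  -- The first argument is fuel, because descending by `g` is not structural; by `ladder-fuel` any
  -- fuel that is at least the index gives the same value.
  ladder : ℕ → ℕ → ℕ
  ladder zero    _       = 0
  ladder (suc _) zero    = 0
  ladder (suc f) (suc N) = a (suc N) + ladder f (suc N ∸ g)

  ladder-fuel : ∀ f f′ N → N ≤ f → N ≤ f′ → ladder f N ≡ ladder f′ N
  ladder-fuel zero    zero     _       _   _   = refl
  ladder-fuel zero    (suc _)  zero    _   _   = refl
  ladder-fuel (suc _) zero     zero    _   _   = refl
  ladder-fuel (suc _) (suc _)  zero    _   _   = refl
  ladder-fuel (suc f) (suc f′) (suc N) N≤f N≤f′ = cong (a (suc N) +_)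
    (ladder-fuel f f′ (suc N ∸ g) (≤-trans (descend N) (s≤s⁻¹ N≤f)) (≤-trans (descend N) (s≤s⁻¹ N≤f′)))

  Θ : ℕ → ℕ
  Θ N = ladder N N

  Θ-suc : ∀ N → Θ (suc N) ≡ a (suc N) + Θ (suc N ∸ g)
  Θ-suc N = cong (a (suc N) +_) (ladder-fuel N (suc N ∸ g) (suc N ∸ g) (descend N) ≤-refl)

  Θ-+g : ∀ m → Θ (m + g) ≡ a (m + g) + Θ m
  Θ-+g m with m + g in eq
  ... | zero  = ⊥-elim (<-irrefl (sym eq) (≤-trans 0<g (m≤n+m g m)))
  ... | suc N = trans (Θ-suc N) (cong (λ x → a (suc N) + Θ x) (trans (cong (_∸ g) (sym eq)) (m+n∸n≡m m g)))

  Θ-short : ∀ m → 1 ≤ m → m ≤ g → Θ m ≡ a m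
  Θ-short (suc m) _ m≤g = trans (Θ-suc m) (trans (cong (λ x → a (suc m) + Θ x) (m≤n⇒m∸n≡0 m≤g)) (+-identityʳ _))

  ladder-zero : ∀ t → ladder t 0 ≡ 0
  ladder-zero zero    = refl
  ladder-zero (suc _) = refl

  -- The offset `o` is what makes the induction work: peeling the head off `applyUpTo f` replaces
  -- `f` by `f ∘ suc`. Once the filter rejects, truncated subtraction makes the index 0, so both
  -- sides vanish.
  filtered-sum : ∀ N o (f : ℕ → ℕ) t → (∀ i → f i ≡ o + i) →
    sum (map (λ i → a (N ∸ i * g)) (filter (λ i → i * g <? N) (applyUpTo f t))) ≡ ladder t (N ∸ o * g)
  filtered-sum N o f zero    f≗ = refl
  filtered-sum N o f (suc t) f≗ with f 0 * g <? N | filtered-sum N (suc o) (f ∘ suc) t (λ i → trans (f≗ (suc i)) (+-suc o i))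
  ... | yes p | ih = trans (cong (sum ∘ map (λ i → a (N ∸ i * g))) (filter-accept (λ i → i * g <? N) p)) (trans (cong₂ (λ x y → a x + y) (cong (λ x → N ∸ x * g) f0≡o) (trans ih (cong (ladder t) step))) (peel (N ∸ o * g) (m<n⇒0<n∸m (subst (λ x → x * g < N) f0≡o p))))
    where
    f0≡o : f 0 ≡ o
    f0≡o = trans (f≗ 0) (+-identityʳ o)
    step : N ∸ (g + o * g) ≡ N ∸ o * g ∸ g
    step = trans (cong (N ∸_) (+-comm g (o * g))) (sym (∸-+-assoc N (o * g) g))
    peel : ∀ M → 0 < M → a M + ladder t (M ∸ g) ≡ ladder (suc t) M
    peel (suc M) _ = refl
  ... | no ¬p | ih = trans (cong (sum ∘ map (λ i → a (N ∸ i * g))) (filter-reject (λ i → i * g <? N) ¬p)) (trans ih (trans (trans (cong (ladder t) (m≤n⇒m∸n≡0 (≤-trans N≤ (m≤n+m (o * g) g)))) (ladder-zero t))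
                                     (sym (cong (ladder (suc t)) (m≤n⇒m∸n≡0 N≤)))))
    where
    N≤ : N ≤ o * g
    N≤ = subst (λ x → N ≤ x * g) (trans (f≗ 0) (+-identityʳ o)) (≮⇒≥ ¬p)

  tailSum≡Θ : ∀ N → tailSum a g (suc N) ≡ Θ N
  tailSum≡Θ N = trans (filtered-sum N 0 id (suc N) (λ _ → refl)) (ladder-fuel (suc N) N N (n≤1+n N) ≤-refl)

  Mono : Set
  Mono = ∀ {m n} → 1 ≤ m → m ≤ n → a m ≤ a n

  Θ-mono : Mono → ∀ {m n} → m ≤ n → Θ m ≤ Θ n
  Θ-mono mono {m} {n} = <-rec (λ n → ∀ m → m ≤ n → Θ m ≤ Θ n) step n m
    where
    step : ∀ n → (∀ {o} → o < n → ∀ m → m ≤ o → Θ m ≤ Θ o) → ∀ m → m ≤ n → Θ m ≤ Θ n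
    step n       ih zero    _   = z≤n
    step (suc n) ih (suc m) m≤n = begin
      Θ (suc m)                     ≡⟨ Θ-suc m ⟩
      a (suc m) + Θ (suc m ∸ g)     ≤⟨ +-mono-≤ (mono (s≤s z≤n) m≤n) (ih (s≤s (descend n)) _ (∸-monoˡ-≤ g m≤n)) ⟩
      a (suc n) + Θ (suc n ∸ g)     ≡⟨ Θ-suc n ⟨
      Θ (suc n)                     ∎
      where open ≤-Reasoning

  a≤Θ : ∀ n → 1 ≤ n → a n ≤ Θ n
  a≤Θ (suc n) _ = subst (a (suc n) ≤_) (sym (Θ-suc n)) (m≤m+n _ _)

-- Index lists without repetition.

remove : ∀ (a : ℕ → ℕ) {i L} → Unique L → i ∈ L →
  Σ (List ℕ) λ L′ → Unique L′ × i ∉ L′ × (∀ {j} → j ∈ L′ → j ∈ L) × sum (map a L) ≡ a i + sum (map a L′)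
remove a {L = _ ∷ L} (i≢L ∷ uniq) (here refl) = L , uniq , (λ i∈L → All.lookup i≢L i∈L refl) , there , refl
remove a {i} {x ∷ L} (x≢L ∷ uniq) (there i∈L) with remove a uniq i∈L
... | L′ , uniq′ , i∉L′ , sub , eq =
  x ∷ L′ , All.tabulate (All.lookup x≢L ∘ sub) ∷ uniq′ ,
  (λ { (here refl) → All.lookup x≢L i∈L refl ; (there p) → i∉L′ p }) ,
  (λ { (here refl) → here refl ; (there p) → there (sub p) }) ,
  trans (cong (a x +_) eq) (x∙yz≈y∙xz +-commutativeSemigroup (a x) (a i) _)

term≤sum : ∀ (a : ℕ → ℕ) {i L} → i ∈ L → a i ≤ sum (map a L)
term≤sum a (here refl) = m≤m+n _ _
term≤sum a (there p)   = m≤n⇒m≤o+n _ (term≤sum a p)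

∣-∣≡⇒+ : ∀ {m n} → m ≤ n → m + ∣ m - n ∣ ≡ n
∣-∣≡⇒+ {m} {n} m≤n = trans (cong (m +_) (m≤n⇒∣m-n∣≡n∸m m≤n)) (m+[n∸m]≡n m≤n)

-- With `g` and `c` as parameters the largest element is `g + c`, and no truncated subtraction
-- `k ∸ c` appears.
record Spaced (S : List ℕ) (g c : ℕ) : Set where
  field
    0<g   : 0 < g
    0<c   : 0 < c
    pos   : All (λ s → 1 ≤ s) S
    k∈S   : g + c ∈ S
    S≤k   : All (λ s → s ≤ g + c) S
    g∉S   : g ∉ S
    below : ∀ m → 1 ≤ m → m < g → m ∈ S

-- Elementary bounds for an LID sequence, and the recurrence from a gap.

module LID {S : List ℕ} {g c : ℕ} (sp : Spaced S g c) {a : ℕ → ℕ} (lid : IsLID S a) where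

  open Spaced sp public
  open Ladder a g 0<g public

  k : ℕ
  k = g + c

  0∉S : 0 ∉ S
  0∉S 0∈S = <-irrefl refl (All.lookup pos 0∈S)

  k<⇒∉S : ∀ {s} → k < s → s ∉ S
  k<⇒∉S k<s s∈S = <⇒≱ k<s (All.lookup S≤k s∈S)

  ∉S⇒g≤ : ∀ {s} → 1 ≤ s → s ∉ S → g ≤ s
  ∉S⇒g≤ 1≤s s∉S = ≮⇒≥ (λ s<g → s∉S (below _ 1≤s s<g))

  spacing : ∀ {i j} → i < j → ∣ i - j ∣ ∉ S → i + g ≤ j
  spacing {i} {j} i<j d∉S = subst (i + g ≤_) (∣-∣≡⇒+ (<⇒≤ i<j))
    (+-monoʳ-≤ i (∉S⇒g≤ (n≢0⇒n>0 (λ d≡0 → <⇒≢ i<j (∣m-n∣≡0⇒m≡n d≡0))) d∉S))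

  Legal : ℕ → List ℕ → Set
  Legal = LegalIndexSet S

  Rep : ℕ → ℕ → Set
  Rep = Representable S a

  legal-mono : ∀ {m n L} → m ≤ n → Legal m L → Legal n L
  legal-mono m≤n (b , u , d) = All.map (λ (1≤i , i<m) → 1≤i , ≤-trans i<m m≤n) b , u , d

  rep-mono : ∀ {m n v} → m ≤ n → Rep m v → Rep n v
  rep-mono m≤n (L , l , eq) = L , legal-mono m≤n l , eq

  rep-one : ∀ {i n} → 1 ≤ i → i < n → Rep n (a i)
  rep-one {i} 1≤i i<n = i ∷ [] , ((1≤i , i<n) ∷ [] , [] ∷ [] , diff) , +-identityʳ _
    where
    diff : ∀ x y → x ∈ i ∷ [] → y ∈ i ∷ [] → ∣ x - y ∣ ∉ S
    diff _ _ (here refl) (here refl) = subst (_∉ S) (sym (∣n-n∣≡0 i)) 0∉S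

  rep-cons : ∀ {n m t} → 1 ≤ n → m ≤ n → (∀ {j} → 1 ≤ j → j < m → ∣ n - j ∣ ∉ S) → Rep m t → Rep (suc n) (a n + t)
  rep-cons {n} {m} 1≤n m≤n far (L , (b , u , d) , eq) =
    n ∷ L ,
    ((1≤n , ≤-refl) ∷ All.map (λ (1≤i , i<m) → 1≤i , m<n⇒m<1+n (<-≤-trans i<m m≤n)) b ,
     All.map (λ (_ , i<m) n≡i → <-irrefl (sym n≡i) (<-≤-trans i<m m≤n)) b ∷ u ,
     diff) , cong (a n +_) eq
    where
    diff : ∀ x y → x ∈ n ∷ L → y ∈ n ∷ L → ∣ x - y ∣ ∉ S
    diff _ _ (here refl) (here refl) = subst (_∉ S) (sym (∣n-n∣≡0 n)) 0∉S
    diff _ _ (here refl) (there p)   = let (1≤j , j<m) = All.lookup b p in far 1≤j j<m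
    diff x _ (there p)   (here refl) = let (1≤j , j<m) = All.lookup b p in subst (_∉ S) (∣-∣-comm n x) (far 1≤j j<m)
    diff x y (there p)   (there q)   = d x y p q

  a-pos : ∀ {n} → 1 ≤ n → 1 ≤ a n
  a-pos 1≤n = proj₁ (lid _ 1≤n)

  a-unrep : ∀ {n} → 1 ≤ n → ¬ Rep n (a n)
  a-unrep 1≤n = proj₁ (proj₂ (lid _ 1≤n))

  below-rep : ∀ {n m} → 1 ≤ n → 1 ≤ m → m < a n → Rep n m
  below-rep 1≤n = proj₂ (proj₂ (lid _ 1≤n)) _

  unrep⇒≤ : ∀ {n v} → 1 ≤ n → 1 ≤ v → ¬ Rep n v → a n ≤ v
  unrep⇒≤ 1≤n 1≤v ¬r = ≮⇒≥ (¬r ∘ below-rep 1≤n 1≤v)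

  -- A smaller value at `suc n` would be representable by indices below `n`, since `a n` is the
  -- least missing value there; an equal value is represented by the index `n` alone.
  a-suc : ∀ {n} → 1 ≤ n → a n < a (suc n)
  a-suc {n} 1≤n with <-cmp (a n) (a (suc n))
  ... | tri< lt _ _ = lt
  ... | tri≈ _ eq _ = ⊥-elim (a-unrep (s≤s z≤n) (subst (Rep (suc n)) eq (rep-one 1≤n ≤-refl)))
  ... | tri> _ _ gt = ⊥-elim (a-unrep (s≤s z≤n) (rep-mono (n≤1+n n) (below-rep 1≤n (a-pos (s≤s z≤n)) gt)))

  a-mono : Mono
  a-mono {m} {zero}  1≤m m≤0 = ⊥-elim (<⇒≱ 1≤m m≤0)
  a-mono {m} {suc n} 1≤m m≤n with m≤n⇒m<n∨m≡n m≤n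
  ... | inj₂ refl = ≤-refl
  ... | inj₁ m<n  = ≤-trans (a-mono 1≤m (s≤s⁻¹ m<n)) (<⇒≤ (a-suc (≤-trans 1≤m (s≤s⁻¹ m<n))))

  a-mono-< : ∀ {m n} → 1 ≤ m → m < n → a m < a n
  a-mono-< 1≤m m<n = <-≤-trans (a-suc 1≤m) (a-mono (s≤s z≤n) m<n)

  n≤a : ∀ n → n ≤ a n
  n≤a zero          = z≤n
  n≤a (suc zero)    = a-pos ≤-refl
  n≤a (suc (suc n)) = ≤-trans (s≤s (n≤a (suc n))) (a-suc (s≤s z≤n))

  n≤Θ : ∀ n → n ≤ Θ n
  n≤Θ zero    = z≤n
  n≤Θ (suc n) = ≤-trans (n≤a (suc n)) (a≤Θ (suc n) (s≤s z≤n))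

  -- Removing the largest index leaves indices at least g smaller, so the sum
  -- is dominated by that of the progression with step g.
  legal-sum≤Θ : ∀ N L → Legal (suc N) L → sum (map a L) ≤ Θ N
  legal-sum≤Θ = <-rec (λ N → ∀ L → Legal (suc N) L → sum (map a L) ≤ Θ N) step
    where
    step : ∀ N → (∀ {M} → M < N → ∀ L → Legal (suc M) L → sum (map a L) ≤ Θ M) →
           ∀ L → Legal (suc N) L → sum (map a L) ≤ Θ N
    step N       ih []      _ = z≤n
    step zero    ih (x ∷ L) (((1≤x , x<1) ∷ _) , _) = ⊥-elim (<⇒≱ x<1 1≤x)
    step (suc N) ih L@(_ ∷ _) (b , u , d) with suc N ∈? L
    ... | no N∉L = ≤-trans (ih ≤-refl L (All.tabulate shrink , u , d)) (Θ-mono a-mono (n≤1+n N))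
      where
      shrink : ∀ {j} → j ∈ L → 1 ≤ j × j < suc N
      shrink j∈L = let (1≤j , j<) = All.lookup b j∈L in
        1≤j , ≤∧≢⇒< (s≤s⁻¹ j<) (λ { refl → N∉L j∈L })
    ... | yes N∈L with remove a u N∈L
    ...   | L′ , u′ , N∉L′ , sub , eq = begin
      sum (map a L)                 ≡⟨ eq ⟩
      a (suc N) + sum (map a L′)    ≤⟨ +-monoʳ-≤ (a (suc N)) (ih (s≤s (descend N)) L′
                                        (All.tabulate shrink , u′ , λ i j p q → d i j (sub p) (sub q))) ⟩
      a (suc N) + Θ (suc N ∸ g)     ≡⟨ Θ-suc N ⟨
      Θ (suc N)                     ∎
      where
      open ≤-Reasoning
      shrink : ∀ {j} → j ∈ L′ → 1 ≤ j × j < suc (suc N ∸ g)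
      shrink {j} p = let (1≤j , j<) = All.lookup b (sub p)
                         j<N = ≤∧≢⇒< (s≤s⁻¹ j<) (λ { refl → N∉L′ p }) in
        1≤j , s≤s (m+n≤o⇒m≤o∸n j (spacing j<N (d _ _ (sub p) N∈L)))

  -- Legal sums of indices at most `n` never exceed `Θ n`, so `suc (Θ n)` is missing.
  a≤1+Θ : ∀ n → a (suc n) ≤ suc (Θ n)
  a≤1+Θ n = unrep⇒≤ (s≤s z≤n) (s≤s z≤n) (λ (L , l , eq) → <⇒≱ (≤-reflexive (sym eq)) (legal-sum≤Θ n L l))

  -- Put `n = k + m`. If this failed, `a (suc n) - a n` would be positive and below `a m`, hence a
  -- legal sum of indices below `m`. These are farther than `k` from `n`, so adding `n` would
  -- represent `a (suc n)`.
  rec-≥ : ∀ m → 1 ≤ m → a (k + m) + a m ≤ a (suc (k + m))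
  rec-≥ m 1≤m = ≮⇒≥ λ lt → a-unrep (s≤s z≤n) (subst (Rep (suc n)) (m+[n∸m]≡n (<⇒≤ (a-suc 1≤n)))
      (rep-cons 1≤n (m≤n+m m k) far (below-rep 1≤m (m<n⇒0<n∸m (a-suc 1≤n))
        (+-cancelˡ-< (a n) _ _ (subst (_< a n + a m) (sym (m+[n∸m]≡n (<⇒≤ (a-suc 1≤n)))) lt)))))
    where
    n = k + m
    1≤n : 1 ≤ n
    1≤n = ≤-trans 1≤m (m≤n+m m k)
    far : ∀ {j} → 1 ≤ j → j < m → ∣ n - j ∣ ∉ S
    far {j} _ j<m = k<⇒∉S (subst (k <_) (sym (trans (∣-∣-comm n j) (m≤n⇒∣m-n∣≡n∸m (≤-trans (<⇒≤ j<m) (m≤n+m m k)))))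
      (m+n≤o⇒m≤o∸n (suc k) (subst (_≤ k + m) (+-suc k j) (+-monoʳ-≤ k j<m))))

  -- Hypothesis (iii) and the recurrence at n = k + 1 + j.
  Gap : ℕ → Set
  Gap j = Θ (k + j) < a (suc (k + j)) + a (suc j)

  Rec : ℕ → Set
  Rec j = a (suc (suc (k + j))) ≡ a (suc (k + j)) + a (suc j)

  -- With `n = suc (k + j)`, one inequality is `rec-≥`. For the other, a representation of
  -- `a n + a (suc j)` without `n` is too small by the gap. One with `n` leaves `a (suc j)` to the
  -- other indices: size excludes those above `suc j`, and `suc j` itself is at the forbidden
  -- distance `k` from `n`. So `a (suc j)` would be a legal sum of smaller indices.
  gap⇒rec : ∀ {j} → Gap j → Rec j
  gap⇒rec {j} gap = ≤-antisym (unrep⇒≤ (s≤s z≤n) (≤-trans (s≤s z≤n) gap) unrep)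
      (subst (λ x → a x + a (suc j) ≤ a (suc x)) (+-suc k j) (rec-≥ (suc j) (s≤s z≤n)))
    where
    n = suc (k + j)
    unrep : ¬ Rep (suc n) (a n + a (suc j))
    unrep (L , (b , u , d) , eq) with n ∈? L
    ... | no n∉L = <⇒≱ gap (subst (_≤ Θ (k + j)) eq (legal-sum≤Θ (k + j) L (All.tabulate shrink , u , d)))
      where
      shrink : ∀ {i} → i ∈ L → 1 ≤ i × i < n
      shrink i∈L = let (1≤i , i<) = All.lookup b i∈L in
        1≤i , ≤∧≢⇒< (s≤s⁻¹ i<) (λ { refl → n∉L i∈L })
    ... | yes n∈L with remove a u n∈L
    ...   | L′ , u′ , n∉L′ , sub , eq′ = a-unrep (s≤s z≤n)
        (L′ , (All.tabulate shrink , u′ , λ i j p q → d i j (sub p) (sub q)) , sum≡)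
      where
      sum≡ : sum (map a L′) ≡ a (suc j)
      sum≡ = +-cancelˡ-≡ (a n) _ _ (trans (sym eq′) eq)
      shrink : ∀ {i} → i ∈ L′ → 1 ≤ i × i < suc j
      shrink {i} p with <-cmp i (suc j)
      ... | tri< lt _ _   = proj₁ (All.lookup b (sub p)) , lt
      ... | tri> _ _ gt   = ⊥-elim (<⇒≱ (a-mono-< (s≤s z≤n) gt) (subst (a i ≤_) sum≡ (term≤sum a p)))
      ... | tri≈ _ refl _ = ⊥-elim (d n (suc j) n∈L (sub p) (subst (_∈ S) (sym diff≡k) k∈S))
        where
        diff≡k : ∣ suc (k + j) - suc j ∣ ≡ k
        diff≡k = trans (∣-∣-comm (k + j) j) (trans (m≤n⇒∣m-n∣≡n∸m (m≤n+m j k)) (m+n∸n≡m k j))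

  -- Up to index `g` the sum `Θ j` is the single term `a j`, so `a≤1+Θ` lets the sequence grow by at
  -- most one per step.
  a≡id : ∀ {j} → 1 ≤ j → j ≤ suc g → a j ≡ j
  a≡id {j} 1≤j j≤ = ≤-antisym (upper j 1≤j j≤) (n≤a j)
    where
    upper : ∀ j → 1 ≤ j → j ≤ suc g → a j ≤ j
    upper (suc zero)    _ _   = a≤1+Θ 0
    upper (suc (suc j)) _ j≤ = ≤-trans (a≤1+Θ (suc j))
      (s≤s (subst (_≤ suc j) (sym (Θ-short (suc j) (s≤s z≤n) (s≤s⁻¹ j≤))) (upper (suc j) (s≤s z≤n) (m≤n⇒m≤1+n (s≤s⁻¹ j≤)))))

  Θ≡id : ∀ {j} → j ≤ g → Θ j ≡ j
  Θ≡id {zero}  _   = refl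
  Θ≡id {suc j} j≤g = trans (Θ-short (suc j) (s≤s z≤n) j≤g) (a≡id (s≤s z≤n) (m≤n⇒m≤1+n j≤g))

-- Certificate for linear arithmetic: `L ≤ R` is a sum of hypotheses, `s` the remaining slack, and
-- the equation is left to the ring solver.
linear : ∀ {x y L R} s → L ≤ R → x + R + s ≡ y + L → x ≤ y
linear {x} {y} {L} {R} s L≤R eq = +-cancelʳ-≤ R x y (begin
  x + R      ≤⟨ m≤m+n (x + R) s ⟩
  x + R + s  ≡⟨ eq ⟩
  y + L      ≤⟨ +-monoʳ-≤ y L≤R ⟩
  y + R      ∎)
  where open ≤-Reasoning

by-slack : ∀ {x y} s → x + s ≡ y → x ≤ y
by-slack {x} s eq = subst (x ≤_) eq (m≤m+n x s)

-- Propagating the window inequality and the gap.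

module Propagation {S : List ℕ} {g c : ℕ} (sp : Spaced S g c) {a : ℕ → ℕ} (lid : IsLID S a) where
  open LID sp lid public

  -- `Rec i` computes the term of index `2 + k + i`, so this covers indices up to `j + c`. For
  -- `j = δ + r` that is the largest index in `X δ r`.
  Below : ℕ → Set
  Below j = ∀ i → c ≤ i → 2 + g + i ≤ j → Rec i

  below-≤ : ∀ {i j} → i ≤ j → Below j → Below i
  below-≤ i≤j b m c≤m le = b m c≤m (≤-trans le i≤j)

  -- The inequality of hypothesis (ii) at n = δ + r, with d = δ.
  X : ℕ → ℕ → Set
  X δ r = a (δ + r + c) + a r ≤ a (δ + r) + a (suc (δ + r))

  rec-at : ∀ {x y z} i → Rec i → suc (suc (k + i)) ≡ x → suc (k + i) ≡ y → suc i ≡ z → a x ≡ a y + a z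
  rec-at i r refl refl refl = r

  -- The recurrence splits each of the four terms in two, so the inequality is the sum of the two
  -- given ones.
  X-step : ∀ δ m → c ≤ m → Below (δ + suc (k + suc m)) → X δ (k + suc m) → X δ (suc m) → X δ (suc (k + suc m))
  X-step δ m c≤m b x₁ x₂ = subst₂ _≤_
      (trans (interchange +-commutativeSemigroup (a _) _ (a _) _) (cong₂ _+_ (sym e₁) (sym e₂)))
      (trans (interchange +-commutativeSemigroup (a _) _ (a _) _) (cong₂ _+_ (sym e₃) (sym e₄)))
      (+-mono-≤ x₁ x₂)
    where
    e₁ : a (δ + suc (k + suc m) + c) ≡ a (δ + (k + suc m) + c) + a (δ + suc m + c)
    e₁ = rec-at (δ + m + c) (b _ (m≤n+m c (δ + m))
           (≤-reflexive (solve 4 (λ d g c m → con 2 :+ g :+ (d :+ m :+ c) := d :+ (con 1 :+ (g :+ c :+ (con 1 :+ m)))) refl δ g c m)))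
         (solve 4 (λ d g c m → con 2 :+ (g :+ c :+ (d :+ m :+ c)) := d :+ (con 1 :+ (g :+ c :+ (con 1 :+ m))) :+ c) refl δ g c m)
         (solve 4 (λ d g c m → con 1 :+ (g :+ c :+ (d :+ m :+ c)) := d :+ (g :+ c :+ (con 1 :+ m)) :+ c) refl δ g c m)
         (solve 3 (λ d c m → con 1 :+ (d :+ m :+ c) := d :+ (con 1 :+ m) :+ c) refl δ c m)
    e₂ : a (suc (k + suc m)) ≡ a (k + suc m) + a (suc m)
    e₂ = rec-at m (b m c≤m
           (by-slack (δ + c) (solve 4 (λ d g c m → con 2 :+ g :+ m :+ (d :+ c) := d :+ (con 1 :+ (g :+ c :+ (con 1 :+ m)))) refl δ g c m)))
         (cong suc (sym (+-suc k m))) (sym (+-suc k m)) refl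
    e₃ : a (δ + suc (k + suc m)) ≡ a (δ + (k + suc m)) + a (δ + suc m)
    e₃ = rec-at (δ + m) (b _ (m≤n⇒m≤o+n δ c≤m)
           (by-slack c (solve 4 (λ d g c m → con 2 :+ g :+ (d :+ m) :+ c := d :+ (con 1 :+ (g :+ c :+ (con 1 :+ m)))) refl δ g c m)))
         (solve 4 (λ d g c m → con 2 :+ (g :+ c :+ (d :+ m)) := d :+ (con 1 :+ (g :+ c :+ (con 1 :+ m)))) refl δ g c m)
         (solve 4 (λ d g c m → con 1 :+ (g :+ c :+ (d :+ m)) := d :+ (g :+ c :+ (con 1 :+ m))) refl δ g c m)
         (sym (+-suc δ m))
    e₄ : a (suc (δ + suc (k + suc m))) ≡ a (suc (δ + (k + suc m))) + a (suc (δ + suc m))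
    e₄ = rec-at (suc (δ + m)) (b _ (m≤n⇒m≤1+n (m≤n⇒m≤o+n δ c≤m))
           (linear 0 0<c (solve 4 (λ d g c m → con 2 :+ g :+ (con 1 :+ (d :+ m)) :+ c :+ con 0 := d :+ (con 1 :+ (g :+ c :+ (con 1 :+ m))) :+ con 1) refl δ g c m)))
         (solve 4 (λ d g c m → con 2 :+ (g :+ c :+ (con 1 :+ (d :+ m))) := con 1 :+ (d :+ (con 1 :+ (g :+ c :+ (con 1 :+ m))))) refl δ g c m)
         (solve 4 (λ d g c m → con 1 :+ (g :+ c :+ (con 1 :+ (d :+ m))) := con 1 :+ (d :+ (g :+ c :+ (con 1 :+ m)))) refl δ g c m)
         (cong suc (sym (+-suc δ m)))

  -- Beyond the window, `r = suc (k + suc m)`, and both `k + suc m` and `suc m` are still at least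
  -- `w`. The condition `c < w` ensures `c ≤ m`, as the recurrence requires.
  X-all : ∀ δ w → c < w → (∀ r → w ≤ r → r ≤ w + k → Below (δ + r) → X δ r) →
          ∀ r → w ≤ r → Below (δ + r) → X δ r
  X-all δ w c<w window = <-rec (λ r → w ≤ r → Below (δ + r) → X δ r) step
    where
    step : ∀ r → (∀ {q} → q < r → w ≤ q → Below (δ + q) → X δ q) → w ≤ r → Below (δ + r) → X δ r
    step r ih w≤r b with r ≤? w + k
    ... | yes r≤ = window r w≤r r≤ b
    ... | no  r≰ with m≤n⇒∃[o]m+o≡n (≰⇒> r≰) | m≤n⇒∃[o]m+o≡n c<w
    ...   | o , refl | c₀ , refl = subst (X δ) (sym eq) (X-step δ m (m≤n⇒m≤n+o o (m≤m+n c c₀)) (subst (λ x → Below (δ + x)) eq b)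
                (ih (≤-reflexive (sym eq)) le₁ (below-≤ (+-monoʳ-≤ δ (≤-trans (n≤1+n _) (≤-reflexive (sym eq)))) b))
                (ih (≤-trans (s≤s (m≤n+m _ k)) (≤-reflexive (sym eq))) (m≤m+n _ o)
                    (below-≤ (+-monoʳ-≤ δ (≤-trans (n≤1+n _) (≤-trans (s≤s (m≤n+m _ k)) (≤-reflexive (sym eq))))) b)))
      where
      m : ℕ
      m = c + c₀ + o
      eq : suc (suc (c + c₀) + k + o) ≡ suc (k + suc m)
      eq = solve 4 (λ g c c₀ o → con 1 :+ (con 1 :+ (c :+ c₀) :+ (g :+ c) :+ o) := con 1 :+ (g :+ c :+ (con 1 :+ (c :+ c₀ :+ o)))) refl g c c₀ o
      le₁ : suc (c + c₀) ≤ k + suc m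
      le₁ = ≤-trans (m≤m+n _ o) (m≤n+m (suc m) k)

  -- Let `j = δ + (2 + (k + i))`. Unfolding twice, `Θ (k + j)` is `a (k + j) + a (j + c) + Θ q`, and
  -- `δ + c + 2 ≤ g` gives `q ≤ k + i`. Then `Gap i` and its recurrence put the tail below
  -- `a (2 + (k + i))`, the inequality `X` exchanges this and `a (j + c)` for `a j + a (suc j)`, and
  -- the recurrence absorbs `a j`.
  gap-step : ∀ δ i → δ + c + 2 ≤ g → Gap i → Rec (suc (δ + (k + i))) → X δ (2 + (k + i)) → Gap (δ + (2 + (k + i)))
  gap-step δ i δ≤ gap rec x = begin-strict
      Θ (k + j)                              ≡⟨ cong Θ eq₁ ⟩
      Θ (j + c + g)                          ≡⟨ Θ-+g (j + c) ⟩
      a (j + c + g) + Θ (j + c)              ≡⟨ cong₂ _+_ (cong a (sym eq₁)) (trans (cong Θ eq₂) (trans (Θ-+g q) (cong (λ y → a y + Θ q) (sym eq₂)))) ⟩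
      a (k + j) + (a (j + c) + Θ q)          ≤⟨ +-monoʳ-≤ (a (k + j)) (+-monoʳ-≤ (a (j + c)) (Θ-mono a-mono q≤)) ⟩
      a (k + j) + (a (j + c) + Θ (k + i))    <⟨ +-monoʳ-< (a (k + j)) (+-monoʳ-< (a (j + c)) (<-≤-trans gap (≤-reflexive (sym (gap⇒rec gap))))) ⟩
      a (k + j) + (a (j + c) + a (2 + (k + i))) ≤⟨ +-monoʳ-≤ (a (k + j)) x ⟩
      a (k + j) + (a j + a (suc j))          ≡⟨ +-assoc (a (k + j)) _ _ ⟨
      a (k + j) + a j + a (suc j)            ≡⟨ cong (_+ a (suc j)) (rec-at (suc (δ + (k + i))) rec eq₃ eq₄ eq₅) ⟨
      a (suc (k + j)) + a (suc j)            ∎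
    where
    open ≤-Reasoning
    j q : ℕ
    j = δ + (2 + (k + i))
    q = δ + 2 + (c + c) + i
    q≤ : q ≤ k + i
    q≤ = linear 0 δ≤ (solve 4 (λ d g c i → d :+ con 2 :+ (c :+ c) :+ i :+ g :+ con 0 := g :+ c :+ i :+ (d :+ c :+ con 2)) refl δ g c i)
    eq₁ : k + j ≡ j + c + g
    eq₁ = solve 3 (λ g c j → g :+ c :+ j := j :+ c :+ g) refl g c j
    eq₂ : j + c ≡ q + g
    eq₂ = solve 4 (λ d g c i → d :+ (con 2 :+ (g :+ c :+ i)) :+ c := d :+ con 2 :+ (c :+ c) :+ i :+ g) refl δ g c i
    eq₅ : suc (suc (δ + (k + i))) ≡ j
    eq₅ = solve 4 (λ d g c i → con 2 :+ (d :+ (g :+ c :+ i)) := d :+ (con 2 :+ (g :+ c :+ i))) refl δ g c i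
    eq₄ : suc (k + suc (δ + (k + i))) ≡ k + j
    eq₄ = trans (sym (+-suc k _)) (cong (k +_) eq₅)
    eq₃ : suc (suc (k + suc (δ + (k + i)))) ≡ suc (k + j)
    eq₃ = cong suc eq₄

  -- The lower bounds on `J` ensure that each `j` beyond it has the form `δ + (2 + (k + i))` with
  -- `c ≤ i`, and that `2 + (k + i)` is not before the start `w` of the window.
  propagate : ∀ δ w J → δ + c + 2 ≤ g → c < w → k + c + δ + 1 ≤ J → δ + w ≤ suc J →
    (∀ r → w ≤ r → r ≤ w + k → Below (δ + r) → X δ r) → (∀ j → c ≤ j → j ≤ J → Gap j) → ∀ j → c ≤ j → Gap j
  propagate δ w J δ≤ c<w J≥ w≤ window known = <-rec (λ j → c ≤ j → Gap j) step
    where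
    step : ∀ j → (∀ {i} → i < j → c ≤ i → Gap i) → c ≤ j → Gap j
    step j ih c≤j with j ≤? J
    ... | yes j≤J = known j c≤j j≤J
    ... | no  j≰J with m≤n⇒∃[o]m+o≡n (≤-trans (s≤s J≥) (≰⇒> j≰J))
    ...   | o , refl = subst Gap (sym eq) (gap-step δ i δ≤ (ih i<j c≤i) (gap⇒rec (ih p<j c≤p))
                (X-all δ w c<w window (2 + (k + i)) w≤r λ m c≤m le → gap⇒rec (ih (m<j m le) c≤m)))
      where
      i : ℕ
      i = c + o
      c≤i : c ≤ i
      c≤i = m≤m+n c o
      eq : suc (k + c + δ + 1) + o ≡ δ + (2 + (k + i))
      eq = solve 4 (λ d g c o → con 1 :+ (g :+ c :+ c :+ d :+ con 1) :+ o := d :+ (con 2 :+ (g :+ c :+ (c :+ o)))) refl δ g c o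
      p<j : suc (δ + (k + i)) < suc (k + c + δ + 1) + o
      p<j = ≤-reflexive (sym (trans eq (trans (+-suc δ (suc (k + i))) (cong suc (+-suc δ (k + i))))))
      c≤p : c ≤ suc (δ + (k + i))
      c≤p = m≤n⇒m≤1+n (m≤n⇒m≤o+n δ (m≤n⇒m≤o+n k c≤i))
      i<j : i < suc (k + c + δ + 1) + o
      i<j = ≤-<-trans (≤-trans (m≤n+m i k) (≤-trans (m≤n+m (k + i) δ) (n≤1+n _))) p<j
      w≤r : w ≤ 2 + (k + i)
      w≤r = +-cancelˡ-≤ δ w _ (subst (δ + w ≤_) eq (≤-trans w≤ (≰⇒> j≰J)))
      -- `Below` asks only for recurrences at indices smaller than the current one, so the induction
      -- hypothesis supplies them.
      m<j : ∀ m → 2 + g + m ≤ δ + (2 + (k + i)) → m < suc (k + c + δ + 1) + o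
      m<j m le = subst (m <_) (sym eq) (≤-trans (s≤s (m≤n+m m (1 + g))) le)

-- Sums over intervals and numerical bounds.

sumFrom : (ℕ → ℕ) → ℕ → ℕ → ℕ
sumFrom f s zero    = 0
sumFrom f s (suc t) = sumFrom f s t + f (s + t)

sumFrom-mono : ∀ {f f′} s s′ t → (∀ i → i < t → f (s + i) ≤ f′ (s′ + i)) → sumFrom f s t ≤ sumFrom f′ s′ t
sumFrom-mono s s′ zero    le = z≤n
sumFrom-mono s s′ (suc t) le = +-mono-≤ (sumFrom-mono s s′ t (λ i i<t → le i (m<n⇒m<1+n i<t))) (le t ≤-refl)

triangle : ℕ → ℕ
triangle zero    = 0
triangle (suc r) = triangle r + suc r

-- Upper bound for a (g + r) when 2 ≤ r ≤ c.
growth : ℕ → ℕ → ℕ → ℕ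
growth c g r = (g + triangle r) ⊓ (g + g + r ∸ (c + c))

-- How much the slack in Window can have decreased after i steps.
loss : ℕ → ℕ → ℕ → ℕ
loss c g zero    = 0
loss c g (suc i) = loss c g i + suc (c + 2 + i ∸ g)

loss-mono : ∀ c g {i j} → i ≤ j → loss c g i ≤ loss c g j
loss-mono c g {i} {zero}  z≤n = ≤-refl
loss-mono c g {i} {suc j} i≤j with m≤n⇒m<n∨m≡n i≤j
... | inj₁ i<j  = ≤-trans (loss-mono c g (s≤s⁻¹ i<j)) (m≤m+n _ _)
... | inj₂ refl = ≤-refl

-- Consequences of (iii) for the dense case.

module Dense {S : List ℕ} {g c : ℕ} (sp : Spaced S g c) {a : ℕ → ℕ} (lid : IsLID S a) where
  open Propagation sp lid public

  -- Cancel `a (k + suc j)`: it is the first term of `Θ` on the left of the gap, and the recurrence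
  -- at `j` produces it on the right.
  gap⇒ladder : ∀ {j} → Rec j → Gap (suc j) → Θ (suc j + c) < a (suc j) + a (suc (suc j))
  gap⇒ladder {j} rec gap = +-cancelˡ-< (a (k + suc j)) _ _ (begin-strict
      a (k + suc j) + Θ (suc j + c)                  ≡⟨ cong (λ x → a x + Θ (suc j + c)) eq ⟩
      a (suc j + c + g) + Θ (suc j + c)              ≡⟨ Θ-+g (suc j + c) ⟨
      Θ (suc j + c + g)                              ≡⟨ cong Θ eq ⟨
      Θ (k + suc j)                                  <⟨ gap ⟩
      a (suc (k + suc j)) + a (suc (suc j))          ≡⟨ cong (_+ a (suc (suc j))) (rec-at j rec (cong suc (sym (+-suc k j))) (sym (+-suc k j)) refl) ⟩
      a (k + suc j) + a (suc j) + a (suc (suc j))    ≡⟨ +-assoc (a (k + suc j)) _ _ ⟩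
      a (k + suc j) + (a (suc j) + a (suc (suc j)))  ∎)
    where
    open ≤-Reasoning
    eq : k + suc j ≡ suc j + c + g
    eq = solve 3 (λ g c j → g :+ c :+ j := j :+ c :+ g) refl g c (suc j)

  LadderBound : Set
  LadderBound = ∀ j → c < j → j ≤ k + g → Θ (j + c) < a j + a (suc j)

  -- If `g ≤ c`, then for `j = suc c` the progression below its first term restarts at or above
  -- `suc c`, so `Θ` already reaches `a (2 + c) + a (suc c)`.
  c<g : LadderBound → c < g
  c<g Y = ≰⇒> λ g≤c → <⇒≱ (Y (suc c) ≤-refl c+1≤) (begin
      a (suc c) + a (2 + c)                            ≡⟨ +-comm (a (suc c)) _ ⟩
      a (2 + c) + a (suc c)                            ≤⟨ +-mono-≤ (a-mono (s≤s z≤n) (s≤s (+-monoˡ-≤ c 0<c)))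
                                                            (≤-trans (a≤Θ (suc c) (s≤s z≤n)) (Θ-mono a-mono (fall g≤c))) ⟩
      a (suc c + c) + Θ (suc c + c ∸ g)                ≡⟨ Θ-suc (c + c) ⟨
      Θ (suc c + c)                                    ∎)
    where
    open ≤-Reasoning
    c+1≤ : suc c ≤ k + g
    c+1≤ = linear 1 (+-mono-≤ 0<g 0<g) (solve 2 (λ g c → con 1 :+ c :+ (g :+ g) :+ con 1 := g :+ c :+ g :+ con 2) refl g c)
    fall : g ≤ c → suc c ≤ suc c + c ∸ g
    fall g≤c = m+n≤o⇒m≤o∸n (suc c) (+-monoʳ-≤ (suc c) g≤c)

  -- Take `j = g`: the right side is `2 g + 1`, while `Θ (g + c)` is at least `(c + g) + c`.
  2c≤g : LadderBound → c + c ≤ g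
  2c≤g Y = s≤s⁻¹ (linear 0 bound (solve 2 (λ g c → con 1 :+ (c :+ c) :+ (g :+ (con 1 :+ g)) :+ con 0 := con 1 :+ g :+ (con 1 :+ (c :+ g :+ c))) refl g c))
    where
    open ≤-Reasoning
    bound : suc (c + g + c) ≤ g + suc g
    bound = begin-strict
      c + g + c                ≤⟨ +-mono-≤ (n≤a (c + g)) (n≤Θ c) ⟩
      a (c + g) + Θ c          ≡⟨ Θ-+g c ⟨
      Θ (c + g)                ≡⟨ cong Θ (+-comm c g) ⟩
      Θ (g + c)                <⟨ Y g (c<g Y) (m≤n+m g k) ⟩
      a g + a (suc g)          ≡⟨ cong₂ _+_ (a≡id 0<g (n≤1+n g)) (a≡id (s≤s z≤n) ≤-refl) ⟩
      g + suc g                ∎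

  -- Here `Θ (g + r)` is just `a (g + r) + r`, so `a≤1+Θ` adds at most `suc r` at each step.
  u≤triangle : ∀ r → r ≤ suc g → a (g + r) ≤ g + triangle r
  u≤triangle zero    _  = ≤-reflexive (trans (cong a (+-identityʳ g)) (trans (a≡id 0<g (n≤1+n g)) (sym (+-identityʳ g))))
  u≤triangle (suc r) r≤ = begin
      a (g + suc r)                ≡⟨ cong a (+-suc g r) ⟩
      a (suc (g + r))              ≤⟨ a≤1+Θ (g + r) ⟩
      suc (Θ (g + r))              ≡⟨ cong (suc ∘ Θ) (+-comm g r) ⟩
      suc (Θ (r + g))              ≡⟨ cong suc (Θ-+g r) ⟩
      suc (a (r + g) + Θ r)        ≡⟨ cong₂ (λ x y → suc (a x + y)) (+-comm r g) (Θ≡id (s≤s⁻¹ r≤)) ⟩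
      suc (a (g + r) + r)          ≤⟨ s≤s (+-monoˡ-≤ r (u≤triangle r (m≤n⇒m≤1+n (s≤s⁻¹ r≤)))) ⟩
      suc (g + triangle r + r)     ≡⟨ solve 3 (λ g t r → con 1 :+ (g :+ t :+ r) := g :+ (t :+ (con 1 :+ r))) refl g (triangle r) r ⟩
      g + (triangle r + suc r)     ∎
    where open ≤-Reasoning

  -- Use the bound at `j = g - c + r`, where `a` is still the identity on `j` and `suc j`, while
  -- `Θ (j + c) = a (g + r) + r`.
  u≤linear : LadderBound → ∀ r → 1 ≤ r → r ≤ c → a (g + r) + (c + c) ≤ g + g + r
  u≤linear Y r 1≤r r≤c with m≤n⇒∃[o]m+o≡n (2c≤g Y)
  ... | h , 2c+h≡g = subst (λ x → a (g + r) + (c + c) ≤ x + x + r) 2c+h≡g (linear 0 bound (solve 4 (λ u c h r → u :+ (c :+ c) :+ (c :+ h :+ r :+ (con 1 :+ (c :+ h :+ r))) :+ con 0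
                        := c :+ c :+ h :+ (c :+ c :+ h) :+ r :+ (con 1 :+ (u :+ r))) refl (a (g + r)) c h r))
    where
    open ≤-Reasoning
    j : ℕ
    j = c + h + r
    j+c : j + c ≡ r + g
    j+c = trans (solve 3 (λ c h r → c :+ h :+ r :+ c := r :+ (c :+ c :+ h)) refl c h r) (cong (r +_) 2c+h≡g)
    j≤g : j ≤ g
    j≤g = subst (j ≤_) 2c+h≡g (linear 0 r≤c (solve 3 (λ c h r → c :+ h :+ r :+ c :+ con 0 := c :+ c :+ h :+ r) refl c h r))
    c<j : c < j
    c<j = linear h 1≤r (solve 3 (λ c h r → con 1 :+ c :+ r :+ h := c :+ h :+ r :+ con 1) refl c h r)
    bound : suc (a (g + r) + r) ≤ j + suc j
    bound = begin-strict
      a (g + r) + r      ≡⟨ cong₂ (λ x y → a x + y) (+-comm g r) (sym (Θ≡id (≤-trans r≤c (<⇒≤ (c<g Y))))) ⟩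
      a (r + g) + Θ r    ≡⟨ Θ-+g r ⟨
      Θ (r + g)          ≡⟨ cong Θ j+c ⟨
      Θ (j + c)          <⟨ Y j c<j (≤-trans j≤g (m≤n+m g k)) ⟩
      a j + a (suc j)    ≡⟨ cong₂ _+_ (a≡id (≤-trans (s≤s z≤n) c<j) (m≤n⇒m≤1+n j≤g)) (a≡id (s≤s z≤n) (s≤s j≤g)) ⟩
      j + suc j          ∎

  u≤growth : LadderBound → ∀ r → 1 ≤ r → r ≤ c → a (g + r) ≤ growth c g r
  u≤growth Y r 1≤r r≤c = ⊓-glb (u≤triangle r (≤-trans r≤c (m≤n⇒m≤1+n (<⇒≤ (c<g Y))))) (m+n≤o⇒m≤o∸n _ (u≤linear Y r 1≤r r≤c))

  climb-≥ : ∀ m t → 1 ≤ m → a (k + m) + sumFrom id m t ≤ a (k + (m + t))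
  climb-≥ m zero    1≤m = ≤-reflexive (trans (+-identityʳ _) (cong (λ x → a (k + x)) (sym (+-identityʳ m))))
  climb-≥ m (suc t) 1≤m = begin
      a (k + m) + (sumFrom id m t + (m + t))    ≡⟨ +-assoc (a (k + m)) _ _ ⟨
      a (k + m) + sumFrom id m t + (m + t)      ≤⟨ +-mono-≤ (climb-≥ m t 1≤m) (n≤a (m + t)) ⟩
      a (k + (m + t)) + a (m + t)               ≤⟨ rec-≥ (m + t) (≤-trans 1≤m (m≤m+n m t)) ⟩
      a (suc (k + (m + t)))                     ≡⟨ cong a (trans (sym (+-suc k (m + t))) (cong (k +_) (sym (+-suc m t)))) ⟩
      a (k + (m + suc t))                       ∎
    where open ≤-Reasoning

  -- From (iii) at j = k + i and j = g + i.
  crowded : LadderBound → ∀ i → i ≤ c →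
    suc (suc (sumFrom id (suc i) (c ∸ 1) + (c + c + i)) + (c + i)) ≤ g + triangle i + (g + triangle (suc i))
  crowded Y i i≤c = begin-strict
      suc (s + (c + c + i)) + (c + i)              ≤⟨ +-mono-≤ (+-cancelˡ-< (a (k + suc i)) _ _ lower) (n≤Θ (c + i)) ⟩
      a (k + i) + Θ (c + i)                        ≡⟨ cong (λ x → a x + Θ (c + i)) eq₁ ⟩
      a (c + i + g) + Θ (c + i)                    ≡⟨ Θ-+g (c + i) ⟨
      Θ (c + i + g)                                ≡⟨ cong Θ eq₂ ⟩
      Θ (g + i + c)                                <⟨ Y (g + i) (m≤n⇒m≤n+o i (c<g Y)) g+i≤ ⟩
      a (g + i) + a (suc (g + i))                  ≡⟨ cong (λ x → a (g + i) + a x) (+-suc g i) ⟨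
      a (g + i) + a (g + suc i)                    ≤⟨ +-mono-≤ (u≤triangle i (≤-trans i≤g (n≤1+n g))) (u≤triangle (suc i) (s≤s i≤g)) ⟩
      g + triangle i + (g + triangle (suc i))      ∎
    where
    open ≤-Reasoning
    s : ℕ
    s = sumFrom id (suc i) (c ∸ 1)
    i≤g : i ≤ g
    i≤g = ≤-trans i≤c (<⇒≤ (c<g Y))
    g+i≤ : g + i ≤ k + g
    g+i≤ = ≤-trans (+-monoʳ-≤ g i≤c) (m≤m+n k g)
    eq₁ : k + i ≡ c + i + g
    eq₁ = solve 3 (λ g c i → g :+ c :+ i := c :+ i :+ g) refl g c i
    eq₂ : c + i + g ≡ g + i + c
    eq₂ = solve 3 (λ g c i → c :+ i :+ g := g :+ i :+ c) refl g c i
    eq₃ : c + c + i + g ≡ k + i + c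
    eq₃ = solve 3 (λ g c i → c :+ c :+ i :+ g := g :+ c :+ i :+ c) refl g c i
    eq₄ : k + (suc i + (c ∸ 1)) ≡ c + c + i + g
    eq₄ = trans (cong (k +_) (trans (sym (+-suc i (c ∸ 1))) (cong (i +_) (m+[n∸m]≡n 0<c))))
                (solve 3 (λ g c i → g :+ c :+ (i :+ c) := c :+ c :+ i :+ g) refl g c i)
    -- The bound at `k + i`, after `climb-≥` exposes `a (k + suc i)` for cancellation, forces
    -- `a (k + i)` to be large; the bound at `g + i` then caps the same term.
    lower : a (k + suc i) + (s + (c + c + i)) < a (k + suc i) + a (k + i)
    lower = begin-strict
      a (k + suc i) + (s + (c + c + i))            ≡⟨ +-assoc (a (k + suc i)) s _ ⟨
      a (k + suc i) + s + (c + c + i)              ≤⟨ +-mono-≤ (climb-≥ (suc i) (c ∸ 1) (s≤s z≤n)) (n≤Θ (c + c + i)) ⟩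
      a (k + (suc i + (c ∸ 1))) + Θ (c + c + i)    ≡⟨ cong (λ x → a x + Θ (c + c + i)) eq₄ ⟩
      a (c + c + i + g) + Θ (c + c + i)            ≡⟨ Θ-+g (c + c + i) ⟨
      Θ (c + c + i + g)                            ≡⟨ cong Θ eq₃ ⟩
      Θ (k + i + c)                                <⟨ Y (k + i) (≤-trans (+-monoˡ-≤ c 0<g) (m≤m+n k i)) (+-monoʳ-≤ k i≤g) ⟩
      a (k + i) + a (suc (k + i))                  ≡⟨ +-comm (a (k + i)) _ ⟩
      a (suc (k + i)) + a (k + i)                  ≡⟨ cong (λ x → a x + a (k + i)) (+-suc k i) ⟨
      a (k + suc i) + a (k + i)                    ∎

  -- The shift makes `Rec j` say that `A` has increments `a (suc j)`.
  A : ℕ → ℕ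
  A j = a (suc (k + j))

  A-suc : ∀ {j} → Rec j → A (suc j) ≡ A j + a (suc j)
  A-suc {j} rec = trans (cong (a ∘ suc) (+-suc k j)) rec

  climb : ∀ j t → (∀ i → i < t → Rec (j + i)) → A (j + t) ≡ A j + sumFrom a (suc j) t
  climb j zero    _   = trans (cong A (+-identityʳ j)) (sym (+-identityʳ _))
  climb j (suc t) rec = begin
      A (j + suc t)                                 ≡⟨ cong A (+-suc j t) ⟩
      A (suc (j + t))                               ≡⟨ A-suc (rec t ≤-refl) ⟩
      A (j + t) + a (suc (j + t))                   ≡⟨ cong (_+ a (suc (j + t))) (climb j t (λ i i<t → rec i (m<n⇒m<1+n i<t))) ⟩
      A j + sumFrom a (suc j) t + a (suc (j + t))   ≡⟨ +-assoc (A j) _ _ ⟩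
      A j + (sumFrom a (suc j) t + a (suc j + t))   ∎
    where open ≡-Reasoning

  -- X (g - c - 2) at δ + r = k + 1 + (g + i).
  Window : ℕ → Set
  Window i = A (g + i + c) + A (c + 2 + i) ≤ A (g + i) + A (suc (g + i))

  -- This compares the growth of the two sides from `Window i` to `Window (suc i)`. The bound at
  -- `suc (g + i)` has `Θ (c + suc i)` where `a (suc (c + 2 + i))` is wanted; two uses of `a≤1+Θ`
  -- exchange them at the cost `2 + (c + 2 + i ∸ g)`, and strictness recovers one.
  increment : LadderBound → c + c < g → ∀ i → i < k →
    a (suc (g + i + c)) + a (suc (c + 2 + i)) ≤ a (suc (g + i)) + a (suc (suc (g + i))) + suc (c + 2 + i ∸ g)
  increment Y 2c<g i i<k = +-cancelʳ-≤ (Θ (c + suc i)) _ _ (begin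
      x + a (suc n) + Θ (c + suc i)           ≡⟨ solve 3 (λ x y z → x :+ y :+ z := x :+ z :+ y) refl x (a (suc n)) _ ⟩
      x + Θ (c + suc i) + a (suc n)           ≡⟨ cong (_+ a (suc n)) (trans (cong (λ y → a y + Θ (c + suc i)) eq₁) (trans (sym (Θ-+g (c + suc i))) (cong Θ (sym eq₁)))) ⟩
      Θ (suc (g + i) + c) + a (suc n)         ≤⟨ +-monoʳ-≤ _ top ⟩
      Θ (suc (g + i) + c) + (suc (Θ (c + suc i)) + suc (n ∸ g)) ≡⟨ solve 3 (λ x y z → x :+ (con 1 :+ y :+ z) := con 1 :+ x :+ z :+ y) refl (Θ (suc (g + i) + c)) (Θ (c + suc i)) (suc (n ∸ g)) ⟩
      suc (Θ (suc (g + i) + c)) + suc (n ∸ g) + Θ (c + suc i) ≤⟨ +-monoˡ-≤ _ (+-monoˡ-≤ _ (Y (suc (g + i)) (m≤n⇒m≤1+n (m≤n⇒m≤n+o i (c<g Y))) g+i≤)) ⟩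
      a (suc (g + i)) + a (suc (suc (g + i))) + suc (n ∸ g) + Θ (c + suc i) ∎)
    where
    open ≤-Reasoning
    n x : ℕ
    n = c + 2 + i
    x = a (suc (g + i + c))
    eq₁ : suc (g + i + c) ≡ c + suc i + g
    eq₁ = solve 3 (λ g c i → con 1 :+ (g :+ i :+ c) := c :+ (con 1 :+ i) :+ g) refl g c i
    g+i≤ : suc (g + i) ≤ k + g
    g+i≤ = linear 0 i<k (solve 3 (λ g c i → con 1 :+ (g :+ i) :+ (g :+ c) :+ con 0 := g :+ c :+ g :+ (con 1 :+ i)) refl g c i)
    n≡ : n ≡ suc (c + suc i)
    n≡ = solve 2 (λ c i → c :+ con 2 :+ i := con 1 :+ (c :+ (con 1 :+ i))) refl c i
    n∸g≤g : n ∸ g ≤ g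
    n∸g≤g = m≤n+o⇒m∸n≤o n g (linear 0 (+-mono-≤ i<k 2c<g) (solve 3 (λ g c i → c :+ con 2 :+ i :+ (g :+ c :+ g) :+ con 0 := g :+ g :+ (con 1 :+ i :+ (con 1 :+ (c :+ c)))) refl g c i))
    top : a (suc n) ≤ suc (Θ (c + suc i)) + suc (n ∸ g)
    top = begin
      a (suc n)                              ≤⟨ a≤1+Θ n ⟩
      suc (Θ n)                              ≡⟨ cong (suc ∘ Θ) n≡ ⟩
      suc (Θ (suc (c + suc i)))              ≡⟨ cong suc (Θ-suc (c + suc i)) ⟩
      suc (a (suc (c + suc i)) + Θ (suc (c + suc i) ∸ g)) ≡⟨ cong (λ y → suc (a (suc (c + suc i)) + Θ (y ∸ g))) n≡ ⟨
      suc (a (suc (c + suc i)) + Θ (n ∸ g))  ≡⟨ cong (λ y → suc (a (suc (c + suc i)) + y)) (Θ≡id n∸g≤g) ⟩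
      suc (a (suc (c + suc i)) + (n ∸ g))    ≡⟨ +-suc _ (n ∸ g) ⟨
      a (suc (c + suc i)) + suc (n ∸ g)      ≤⟨ +-monoˡ-≤ _ (a≤1+Θ (c + suc i)) ⟩
      suc (Θ (c + suc i)) + suc (n ∸ g)      ∎

  -- At `i = 0` the slack is the sum of `a` over `c + 3, ..., g` minus its sum over
  -- `g + 2, ..., g + c`. The budget makes this cover the losses of all `k` steps.
  window-by-budget : LadderBound → (∀ j → c ≤ j → j ≤ k + g → Rec j) → c + c < g →
    sumFrom (growth c g) 2 (c ∸ 1) + loss c g k ≤ sumFrom id (c + 3) (g ∸ (c + 2)) →
    ∀ i → i ≤ k → Below (suc (k + (g + i))) → Window i
  window-by-budget Y R 2c<g budget i i≤k b =
    +-cancelʳ-≤ (loss c g k) _ _ (≤-trans (slack i i≤k b) (+-monoʳ-≤ _ (loss-mono c g i≤k)))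
    where
    open ≤-Reasoning
    h : ℕ
    h = g ∸ (c + 2)
    c+2+h : c + 2 + h ≡ g
    c+2+h = m+[n∸m]≡n (≤-trans (linear 0 0<c (solve 1 (λ c → c :+ con 2 :+ c :+ con 0 := con 1 :+ (c :+ c) :+ con 1) refl c)) 2c<g)
    heads : sumFrom a (2 + g) (c ∸ 1) ≤ sumFrom (growth c g) 2 (c ∸ 1)
    heads = sumFrom-mono (2 + g) 2 (c ∸ 1) λ i i< → subst (λ x → a x ≤ growth c g (2 + i))
      (solve 2 (λ g i → g :+ (con 2 :+ i) := con 2 :+ g :+ i) refl g i)
      (u≤growth Y (2 + i) (s≤s z≤n) (≤-trans (s≤s i<) (≤-reflexive (m+[n∸m]≡n 0<c))))
    feet : sumFrom id (c + 3) h ≤ sumFrom a (suc (c + 2)) h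
    feet = sumFrom-mono (c + 3) (suc (c + 2)) h λ i _ → ≤-trans (≤-reflexive (cong (_+ i) (+-suc c 2))) (n≤a (suc (c + 2) + i))
    upper : A (g + 0 + c) ≡ A (suc (g + 0)) + sumFrom a (2 + g) (c ∸ 1)
    upper = trans (cong A (trans (cong (g + 0 +_) (sym (m+[n∸m]≡n 0<c))) (+-suc (g + 0) (c ∸ 1))))
      (trans (climb (suc (g + 0)) (c ∸ 1) (λ i i< → R _ (≤-trans (<⇒≤ (c<g Y)) (≤-trans (≤-trans (m≤m+n g 0) (n≤1+n _)) (m≤m+n _ i)))
        (≤-trans (s≤s (≤-trans (≤-reflexive (cong (_+ i) (+-identityʳ g))) (+-monoʳ-≤ g (<⇒≤ i<)))) (≤-trans (≤-reflexive (trans (sym (+-suc g (c ∸ 1))) (cong (g +_) (m+[n∸m]≡n 0<c)))) (m≤m+n k g)))))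
      (cong (λ x → A (suc (g + 0)) + sumFrom a (suc (suc x)) (c ∸ 1)) (+-identityʳ g)))
    lower : A (g + 0) ≡ A (c + 2 + 0) + sumFrom a (suc (c + 2)) h
    lower = trans (cong A (trans (+-identityʳ g) (sym c+2+h)))
      (trans (climb (c + 2) h (λ i i<h → R _ (≤-trans (m≤m+n c 2) (m≤m+n _ i)) (≤-trans (≤-trans (+-monoʳ-≤ (c + 2) (<⇒≤ i<h)) (≤-reflexive c+2+h)) (m≤n+m g k))))
      (cong (λ x → A x + sumFrom a (suc (c + 2)) h) (sym (+-identityʳ (c + 2)))))
    -- Invariant: after `i` steps the slack is at least `loss c g k - loss c g i`.
    slack : ∀ i → i ≤ k → Below (suc (k + (g + i))) →
      A (g + i + c) + A (c + 2 + i) + loss c g k ≤ A (g + i) + A (suc (g + i)) + loss c g i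
    slack zero _ _ = begin
      A (g + 0 + c) + A (c + 2 + 0) + loss c g k    ≡⟨ cong (λ y → y + A (c + 2 + 0) + loss c g k) upper ⟩
      A (suc (g + 0)) + sumFrom a (2 + g) (c ∸ 1) + A (c + 2 + 0) + loss c g k ≤⟨ +-monoˡ-≤ _ (+-monoˡ-≤ _ (+-monoʳ-≤ (A (suc (g + 0))) heads)) ⟩
      A (suc (g + 0)) + s + A (c + 2 + 0) + loss c g k ≡⟨ solve 4 (λ x y z w → x :+ y :+ z :+ w := x :+ z :+ (y :+ w)) refl (A (suc (g + 0))) s (A (c + 2 + 0)) (loss c g k) ⟩
      A (suc (g + 0)) + A (c + 2 + 0) + (s + loss c g k) ≤⟨ +-monoʳ-≤ _ (≤-trans budget feet) ⟩
      A (suc (g + 0)) + A (c + 2 + 0) + sumFrom a (suc (c + 2)) h ≡⟨ +-assoc (A (suc (g + 0))) _ _ ⟩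
      A (suc (g + 0)) + (A (c + 2 + 0) + sumFrom a (suc (c + 2)) h) ≡⟨ cong (A (suc (g + 0)) +_) lower ⟨
      A (suc (g + 0)) + A (g + 0)                   ≡⟨ +-comm (A (suc (g + 0))) _ ⟩
      A (g + 0) + A (suc (g + 0))                   ≡⟨ +-identityʳ _ ⟨
      A (g + 0) + A (suc (g + 0)) + 0               ∎
      where
      s : ℕ
      s = sumFrom (growth c g) 2 (c ∸ 1)
    slack (suc i) i<k b = begin
      A (g + suc i + c) + A (c + 2 + suc i) + loss c g k
        ≡⟨ cong (_+ loss c g k) (cong₂ _+_ e₁ e₂) ⟩
      p + u + (q + v) + loss c g k
        ≡⟨ solve 5 (λ p u q v l → p :+ u :+ (q :+ v) :+ l := p :+ q :+ l :+ (u :+ v)) refl p u q v (loss c g k) ⟩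
      p + q + loss c g k + (u + v)
        ≤⟨ +-mono-≤ (slack i (<⇒≤ i<k) (below-≤ (s≤s (+-monoʳ-≤ k (+-monoʳ-≤ g (n≤1+n i)))) b)) (increment Y 2c<g i i<k) ⟩
      p′ + q′ + loss c g i + (u′ + v′ + suc (c + 2 + i ∸ g))
        ≡⟨ solve 6 (λ p u q v l m → p :+ q :+ l :+ (u :+ v :+ m) := p :+ u :+ (q :+ v) :+ (l :+ m)) refl p′ u′ q′ v′ (loss c g i) (suc (c + 2 + i ∸ g)) ⟩
      p′ + u′ + (q′ + v′) + loss c g (suc i)
        ≡⟨ cong (_+ loss c g (suc i)) (cong₂ _+_ e₃ e₄) ⟨
      A (g + suc i) + A (suc (g + suc i)) + loss c g (suc i) ∎
      where
      p q u v p′ q′ u′ v′ : ℕ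
      p  = A (g + i + c)
      q  = A (c + 2 + i)
      u  = a (suc (g + i + c))
      v  = a (suc (c + 2 + i))
      p′ = A (g + i)
      q′ = A (suc (g + i))
      u′ = a (suc (g + i))
      v′ = a (suc (suc (g + i)))
      c≤g+i : c ≤ g + i
      c≤g+i = m≤n⇒m≤n+o i (<⇒≤ (c<g Y))
      g+i< : suc (g + i) ≤ k + g
      g+i< = linear 0 i<k (solve 3 (λ g c i → con 1 :+ (g :+ i) :+ (g :+ c) :+ con 0 := g :+ c :+ g :+ (con 1 :+ i)) refl g c i)
      e₁ : A (g + suc i + c) ≡ p + u
      e₁ = trans (cong (λ x → A (x + c)) (+-suc g i)) (A-suc (b _ (m≤n+m c (g + i))
        (≤-reflexive (solve 3 (λ g c i → con 2 :+ g :+ (g :+ i :+ c) := con 1 :+ (g :+ c :+ (g :+ (con 1 :+ i)))) refl g c i))))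
      e₂ : A (c + 2 + suc i) ≡ q + v
      e₂ = trans (cong A (+-suc (c + 2) i)) (A-suc (b _ (≤-trans (m≤m+n c 2) (m≤m+n _ i))
        (linear 0 (+-mono-≤ (c<g Y) 0<c) (solve 3 (λ g c i → con 2 :+ g :+ (c :+ con 2 :+ i) :+ (g :+ c) :+ con 0
          := con 1 :+ (g :+ c :+ (g :+ (con 1 :+ i))) :+ (con 1 :+ c :+ con 1)) refl g c i))))
      e₃ : A (g + suc i) ≡ p′ + u′
      e₃ = trans (cong A (+-suc g i)) (A-suc (R _ c≤g+i (<⇒≤ g+i<)))
      e₄ : A (suc (g + suc i)) ≡ q′ + v′
      e₄ = trans (cong (A ∘ suc) (+-suc g i)) (A-suc (R _ (m≤n⇒m≤1+n c≤g+i) g+i<))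

-- The finite search as a computation on lists.

allBelow : (ℕ → Bool) → ℕ → Bool
allBelow p zero    = true
allBelow p (suc n) = p n ∧ allBelow p n

anyBelow : (ℕ → Bool) → ℕ → Bool
anyBelow p zero    = false
anyBelow p (suc n) = p n ∨ anyBelow p n

at : ℕ → List ℕ → ℕ
at _       []       = 0
at zero    (x ∷ _)  = x
at (suc p) (_ ∷ xs) = at p xs

-- With `p = g - 1`, on terms listed latest first, this computes `Θ`; the second argument is fuel.
stride : ℕ → ℕ → List ℕ → ℕ
stride p zero    _        = 0
stride p (suc f) []       = 0
stride p (suc f) (x ∷ xs) = x + stride p f (drop p xs)

member : ℕ → List ℕ → Bool
member v []       = false
member v (x ∷ xs) = (v ≡ᵇ x) ∨ member v xs

-- When the fuel runs out the result may still lie in `P`; `extend` tests for that separately.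
search : ℕ → List ℕ → ℕ → ℕ
search zero    P v = v
search (suc f) P v = if member v P then search f P (suc v) else v

-- The value `x` belongs to the latest index. Its partner `j` contributes `j` itself, because the
-- partner is always in the range of `a≡id`.
pairSums : ℕ → ℕ → List Bool → List ℕ → List ℕ
pairSums x j []           P = P
pairSums x j (true  ∷ bs) P = x + j ∷ pairSums x (suc j) bs P
pairSums x j (false ∷ bs) P = pairSums x (suc j) bs P

-- Lists of naturals hold an initial segment of the sequence, latest term first; P holds the sums of
-- legal pairs of indices.  No legal set inside {1, ..., k + c} has three elements when 2 c ≤ g.
module Search (g c : ℕ) where

  period : ℕ
  period = g + c

  advance : List ℕ → List ℕ
  advance xs = at 0 xs + at period xs ∷ xs

  -- True if hypothesis (iii) fails at n = k + 1 + (length xs - c).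
  violated : List ℕ → Bool
  violated xs = at c xs + at (c ∸ 1) xs ≤ᵇ stride (g ∸ 1) (period + period) xs

  -- This is `Window i` when the head of the list is `A (g + i + c)`.
  fits : List ℕ → Bool
  fits xs = at 0 xs + at (g ∸ 2) xs ≤ᵇ at c xs + at (c ∸ 1) xs

  closing : ℕ → List ℕ → Bool
  closing zero    xs = true
  closing (suc m) xs = fits (advance xs) ∧ closing m (advance xs)

  settle : ℕ → List ℕ → Bool
  -- Reached from `grow`, the list here has length `2 * period`, and the rounds of `closing` test
  -- `Window i` for `i = 0, ..., period`.
  settle zero    xs = violated xs ∨ ((c + 2 ≤ᵇ g) ∧ closing (suc period) xs)
  settle (suc m) xs = violated xs ∨ settle m (advance xs)

  grow   : ℕ → ℕ → List ℕ → List Bool → List ℕ → Bool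
  extend : ℕ → ℕ → List ℕ → List Bool → List ℕ → ℕ → Bool
  branch : ℕ → ℕ → List ℕ → List Bool → List ℕ → Bool

  grow zero    n xs bs P = settle (g ∸ 1) xs
  grow (suc m) n xs bs P = violated xs ∨ extend m n xs bs P′ (search (g + c) P′ (suc (at 0 xs)))
    where
    P′ : List ℕ
    P′ = pairSums (at 0 xs) 1 bs P

  extend m n xs bs P v = not (member v P) ∧ branch m n (v ∷ xs) bs P

  branch m n xs bs P =
    -- Membership of `n` in `S` is free below `period`; `period` itself is in `S`, and nothing
    -- larger is.
    if n <ᵇ period then grow m (suc n) xs (true ∷ bs) P ∧ grow m (suc n) xs (false ∷ bs) P
    else if n ≡ᵇ period then grow m (suc n) xs (false ∷ bs) P
    else grow m (suc n) xs (true ∷ bs) P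

  -- The search starts from the identity terms up to `g + 1`, with `true` recording `g ∉ S`. The
  -- next `c + c` terms end at index `k + c + 1`, after which the recurrence produces the sequence.
  explore : Bool
  explore = grow (c + c) (suc g) (applyDownFrom suc (suc g)) (true ∷ []) []

  affordable : Bool
  affordable = (c + c <ᵇ g) ∧ (sumFrom (growth c g) 2 (c ∸ 1) + loss c g (g + c) ≤ᵇ sumFrom id (c + 3) (g ∸ (c + 2)))

  overcrowded : ℕ → Bool
  overcrowded i = g + triangle i + (g + triangle (suc i)) ≤ᵇ suc (sumFrom id (suc i) (c ∸ 1) + (c + c + i)) + (c + i)

  resolved : Bool
  resolved = affordable ∨ (anyBelow overcrowded (suc c) ∨ explore)

-- The parametrisation builds in `0 < c` and `2 c ≤ g`; `rows` runs up to `g = 7 c`.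
row : ℕ → ℕ → Bool
row c h = Search.resolved (suc c + suc c + h) (suc c)

rows : ℕ → Bool
rows c = allBelow (row c) (suc (5 * suc c))

-- From Boolean tests to propositions.

true⇒T : ∀ {b} → b ≡ true → T b
true⇒T refl = tt

∨-true : ∀ x {y} → x ∨ y ≡ true → x ≡ true ⊎ y ≡ true
∨-true true  _  = inj₁ refl
∨-true false eq = inj₂ eq

∧-true : ∀ x {y} → x ∧ y ≡ true → x ≡ true × y ≡ true
∧-true true eq = refl , eq

≤ᵇ-true : ∀ {m n} → (m ≤ᵇ n) ≡ true → m ≤ n
≤ᵇ-true {m} {n} = ≤ᵇ⇒≤ m n ∘ true⇒T

<ᵇ-true : ∀ {m n} → (m <ᵇ n) ≡ true → m < n
<ᵇ-true {m} {n} = <ᵇ⇒< m n ∘ true⇒T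

allBelow-true : ∀ p n → allBelow p n ≡ true → ∀ {i} → i < n → p i ≡ true
allBelow-true p (suc n) eq i<n with ∧-true (p n) eq | m≤n⇒m<n∨m≡n (s≤s⁻¹ i<n)
... | pn , _    | inj₂ refl = pn
... | _  , rest | inj₁ i<   = allBelow-true p n rest i<

anyBelow-true : ∀ p n → anyBelow p n ≡ true → Σ ℕ λ i → i < n × p i ≡ true
anyBelow-true p (suc n) eq with ∨-true (p n) eq
... | inj₁ pn   = n , ≤-refl , pn
... | inj₂ rest with anyBelow-true p n rest
...   | i , i<n , pi = i , m<n⇒m<1+n i<n , pi

member⇒∈ : ∀ v P → member v P ≡ true → v ∈ P
member⇒∈ v (x ∷ P) eq with ∨-true (v ≡ᵇ x) eq
... | inj₁ v≡x = here (≡ᵇ⇒≡ v x (true⇒T v≡x))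
... | inj₂ v∈P = there (member⇒∈ v P v∈P)

∈⇒member : ∀ {v P} → v ∈ P → T (member v P)
∈⇒member {v} {x ∷ P} v∈ with v ≡ᵇ x in eq | v∈
... | true  | _        = tt
... | false | here refl = ⊥-elim (subst T eq (≡⇒≡ᵇ v v refl))
... | false | there p  = ∈⇒member p

member-false : ∀ {v P} → not (member v P) ≡ true → v ∉ P
member-false {v} {P} eq v∈P with member v P | ∈⇒member v∈P
member-false () _ | true | _

search-spec : ∀ f P v → v ≤ search f P v × (∀ m → v ≤ m → m < search f P v → m ∈ P)
search-spec zero    P v = ≤-refl , λ m v≤m m<v → ⊥-elim (<⇒≱ m<v v≤m)
search-spec (suc f) P v with member v P in eq
... | false = ≤-refl , λ m v≤m m<v → ⊥-elim (<⇒≱ m<v v≤m)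
... | true  with search-spec f P (suc v)
...   | le , hit = <⇒≤ le , λ m v≤m m< → case-≤ (m≤n⇒m<n∨m≡n v≤m) m<
  where
  case-≤ : ∀ {m} → v < m ⊎ v ≡ m → m < search f P (suc v) → m ∈ P
  case-≤ (inj₁ v<m)  m< = hit _ v<m m<
  case-≤ (inj₂ refl) _  = member⇒∈ v P eq

pairSums-keep : ∀ {m} x j bs P → m ∈ P → m ∈ pairSums x j bs P
pairSums-keep x j []           P p = p
pairSums-keep x j (true  ∷ bs) P p = there (pairSums-keep x (suc j) bs P p)
pairSums-keep x j (false ∷ bs) P p = pairSums-keep x (suc j) bs P p

-- Correctness of the finite search.

module Exploration {S : List ℕ} {g c : ℕ} (sp : Spaced S g c) {a : ℕ → ℕ} (lid : IsLID S a) where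
  open Dense sp lid public
  open Search g c

  -- The booleans say which of the differences d - 1, d - 2, ..., g are not in S.
  data Bits : ℕ → List Bool → Set where
    start     : Bits g []
    allowed   : ∀ {d bs} → d ∉ S → Bits d bs → Bits (suc d) (true ∷ bs)
    forbidden : ∀ {d bs} → d ∈ S → Bits d bs → Bits (suc d) (false ∷ bs)

  bits-≥ : ∀ {d bs} → Bits d bs → g ≤ d
  bits-≥ start           = ≤-refl
  bits-≥ (allowed _ b)   = m≤n⇒m≤1+n (bits-≥ b)
  bits-≥ (forbidden _ b) = m≤n⇒m≤1+n (bits-≥ b)

  -- Bits run down from the difference `d - 1`, so position `t` decides the difference `e` with
  -- `e + suc t ≡ d`.
  pairSums-complete : ∀ {d bs} → Bits d bs → ∀ x j P e t → e + suc t ≡ d → g ≤ e → e ∉ S → x + (j + t) ∈ pairSums x j bs P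
  pairSums-complete start x j P e t eq g≤e _ = ⊥-elim (<⇒≱ (subst (e <_) eq (m<m+n e (s≤s z≤n))) g≤e)
  pairSums-complete (allowed _ b) x j P e zero eq g≤e e∉ = here (cong (x +_) (+-identityʳ j))
  pairSums-complete (forbidden d∈ b) x j P e zero eq g≤e e∉ =
    ⊥-elim (e∉ (subst (_∈ S) (suc-injective (trans (sym eq) (+-comm e 1))) d∈))
  pairSums-complete (allowed {bs = bs} _ b) x j P e (suc t) eq g≤e e∉ = there (subst (λ y → x + y ∈ pairSums x (suc j) bs P) (sym (+-suc j t))
    (pairSums-complete b x (suc j) P e t (suc-injective (trans (sym (+-suc e (suc t))) eq)) g≤e e∉))
  pairSums-complete (forbidden {bs = bs} _ b) x j P e (suc t) eq g≤e e∉ = subst (λ y → x + y ∈ pairSums x (suc j) bs P) (sym (+-suc j t))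
    (pairSums-complete b x (suc j) P e t (suc-injective (trans (sym (+-suc e (suc t))) eq)) g≤e e∉)

  pairSums-sound : ∀ {d bs} → Bits d bs → ∀ x j P {m} → m ∈ pairSums x j bs P →
    m ∈ P ⊎ Σ ℕ λ e → Σ ℕ λ t → e + suc t ≡ d × g ≤ e × e ∉ S × m ≡ x + (j + t)
  pairSums-sound start x j P p = inj₁ p
  pairSums-sound (allowed {d} d∉ b) x j P (here refl) =
    inj₂ (d , 0 , +-comm d 1 , bits-≥ b , d∉ , cong (x +_) (sym (+-identityʳ j)))
  pairSums-sound (allowed d∉ b) x j P (there p) with pairSums-sound b x (suc j) P p
  ... | inj₁ q = inj₁ q
  ... | inj₂ (e , t , eq , g≤e , e∉ , refl) = inj₂ (e , suc t , trans (+-suc e (suc t)) (cong suc eq) , g≤e , e∉ , cong (x +_) (sym (+-suc j t)))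
  pairSums-sound (forbidden d∈ b) x j P p with pairSums-sound b x (suc j) P p
  ... | inj₁ q = inj₁ q
  ... | inj₂ (e , t , eq , g≤e , e∉ , refl) = inj₂ (e , suc t , trans (+-suc e (suc t)) (cong suc eq) , g≤e , e∉ , cong (x +_) (sym (+-suc j t)))

  Complete : ℕ → List ℕ → Set
  Complete n P = ∀ e j → 1 ≤ e → 1 ≤ j → e + j < n → e ∉ S → a (e + j) + a j ∈ P

  Sound : ℕ → List ℕ → Set
  Sound n P = ∀ {m} → m ∈ P → Rep n m

  rep-pair : ∀ e j → 1 ≤ e → 1 ≤ j → e ∉ S → Rep (suc (e + j)) (a (e + j) + a j)
  rep-pair e j 1≤e 1≤j e∉ = e + j ∷ j ∷ [] ,
      ((≤-trans 1≤j (m≤n+m j e) , ≤-refl) ∷ (1≤j , s≤s (m≤n+m j e)) ∷ [] ,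
       ((λ eq → <⇒≢ (m<n+m j 1≤e) (sym eq)) ∷ []) ∷ [] ∷ [] , diff) ,
      cong (a (e + j) +_) (+-identityʳ (a j))
    where
    e+j-j : ∣ j - e + j ∣ ≡ e
    e+j-j = trans (m≤n⇒∣m-n∣≡n∸m (m≤n+m j e)) (m+n∸n≡m e j)
    diff : ∀ x y → x ∈ e + j ∷ j ∷ [] → y ∈ e + j ∷ j ∷ [] → ∣ x - y ∣ ∉ S
    diff _ _ (here refl)         (here refl)         = subst (_∉ S) (sym (∣n-n∣≡0 (e + j))) 0∉S
    diff _ _ (here refl)         (there (here refl)) = subst (_∉ S) (sym (trans (∣-∣-comm (e + j) j) e+j-j)) e∉
    diff _ _ (there (here refl)) (here refl)         = subst (_∉ S) (sym e+j-j) e∉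
    diff _ _ (there (here refl)) (there (here refl)) = subst (_∉ S) (sym (∣n-n∣≡0 j)) 0∉S

  data Shape (n v : ℕ) : Set where
    empty  : v ≡ 0 → Shape n v
    single : ∀ i → 1 ≤ i → i ≤ n → v ≡ a i → Shape n v
    pair   : ∀ e j → 1 ≤ e → 1 ≤ j → e + j ≤ n → e ∉ S → v ≡ a (e + j) + a j → Shape n v

  -- Three indices spaced by at least `g` would span `2 g`, which does not fit into `1, ..., n`.
  shape : ∀ {n v} → n ≤ g + g → Rep (suc n) v → Shape n v
  shape n≤2g ([] , _ , eq) = empty (sym eq)
  shape n≤2g (i ∷ [] , ((1≤i , i<) ∷ _ , _) , eq) = single i 1≤i (s≤s⁻¹ i<) (trans (sym eq) (+-identityʳ (a i)))
  shape {n} {v} n≤2g (x ∷ y ∷ [] , ((1≤x , x<) ∷ (1≤y , y<) ∷ [] , (x≢y ∷ _) ∷ _ , d) , eq) with <-cmp x y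
  ... | tri≈ _ x≡y _ = ⊥-elim (x≢y x≡y)
  ... | tri> _ _ y<x = pair (x ∸ y) y (m<n⇒0<n∸m y<x) 1≤y (subst (_≤ n) (sym back) (s≤s⁻¹ x<))
        (subst (_∉ S) (trans (∣-∣-comm x y) (m≤n⇒∣m-n∣≡n∸m (<⇒≤ y<x))) (d x y (here refl) (there (here refl))))
        (trans (sym eq) (cong₂ (λ p q → a p + q) (sym back) (+-identityʳ (a y))))
    where
    back : x ∸ y + y ≡ x
    back = m∸n+n≡m (<⇒≤ y<x)
  ... | tri< x<y _ _ = pair (y ∸ x) x (m<n⇒0<n∸m x<y) 1≤x (subst (_≤ n) (sym back) (s≤s⁻¹ y<))
        (subst (_∉ S) (m≤n⇒∣m-n∣≡n∸m (<⇒≤ x<y)) (d x y (here refl) (there (here refl))))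
        (trans (sym eq) (trans (cong (a x +_) (+-identityʳ (a y))) (trans (+-comm (a x) (a y)) (cong (λ p → a p + a x) (sym back)))))
    where
    back : y ∸ x + x ≡ y
    back = m∸n+n≡m (<⇒≤ x<y)
  shape {n} n≤2g (x ∷ y ∷ z ∷ L , (b , (x≢y ∷ x≢z ∷ _) ∷ (y≢z ∷ _) ∷ _ , d) , eq) = ⊥-elim (sort (<-cmp x y) (<-cmp y z) (<-cmp x z))
    where
    L′ : List ℕ
    L′ = x ∷ y ∷ z ∷ L
    x∈ : x ∈ L′
    x∈ = here refl
    y∈ : y ∈ L′
    y∈ = there (here refl)
    z∈ : z ∈ L′
    z∈ = there (there (here refl))
    chain : ∀ {p q r} → p ∈ L′ → q ∈ L′ → r ∈ L′ → p < q → q < r → ⊥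
    chain {p} {q} {r} p∈ q∈ r∈ p<q q<r = <⇒≱ (proj₁ (All.lookup b p∈))
      (linear 0 (≤-trans (+-monoˡ-≤ g (spacing p<q (d _ _ p∈ q∈))) (≤-trans (spacing q<r (d _ _ q∈ r∈)) (≤-trans (s≤s⁻¹ (proj₂ (All.lookup b r∈))) n≤2g)))
        (solve 2 (λ p g → p :+ (g :+ g) :+ con 0 := con 0 :+ (p :+ g :+ g)) refl p g))
    sort : _ → _ → _ → ⊥
    sort (tri≈ _ e _) _ _ = x≢y e
    sort _ (tri≈ _ e _) _ = y≢z e
    sort _ _ (tri≈ _ e _) = x≢z e
    sort (tri< l _ _) (tri< m _ _) _ = chain x∈ y∈ z∈ l m
    sort (tri< l _ _) (tri> _ _ m) (tri< o _ _) = chain x∈ z∈ y∈ o m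
    sort (tri< l _ _) (tri> _ _ m) (tri> _ _ o) = chain z∈ x∈ y∈ o l
    sort (tri> _ _ l) (tri< m _ _) (tri< o _ _) = chain y∈ x∈ z∈ l o
    sort (tri> _ _ l) (tri< m _ _) (tri> _ _ o) = chain y∈ z∈ x∈ m o
    sort (tri> _ _ l) (tri> _ _ m) _ = chain z∈ y∈ x∈ m l

  -- By `shape`, a representable value above `a n` is a pair sum and so lies in `P`; conversely
  -- everything in `P` is representable.
  next-term : ∀ {n v P} → 1 ≤ n → n ≤ g + g → Complete (suc n) P → Sound (suc n) P → a n < v → v ∉ P →
    (∀ m → suc (a n) ≤ m → m < v → m ∈ P) → a (suc n) ≡ v
  next-term {n} {v} {P} 1≤n n≤2g complete sound a<v v∉P hit =
      ≤-antisym (unrep⇒≤ (s≤s z≤n) (≤-trans (s≤s z≤n) a<v) (unrep ∘ shape n≤2g)) (≮⇒≥ λ lt → a-unrep (s≤s z≤n) (sound (hit _ (a-suc 1≤n) lt)))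
    where
    unrep : ¬ Shape n v
    unrep (empty refl)          = <⇒≱ a<v z≤n
    unrep (single i 1≤i i≤ eq)  = <⇒≱ a<v (≤-trans (≤-reflexive eq) (a-mono 1≤i i≤))
    unrep (pair e j 1≤e 1≤j le e∉ refl) = v∉P (complete e j 1≤e 1≤j (s≤s le) e∉)

  vals : ℕ → List ℕ
  vals = applyDownFrom (a ∘ suc)

  at-vals : ∀ p m → at p (vals (p + suc m)) ≡ a (suc m)
  at-vals zero    m = refl
  at-vals (suc p) m = at-vals p m

  at-vals′ : ∀ {n} p m → n ≡ p + suc m → at p (vals n) ≡ a (suc m)
  at-vals′ p m refl = at-vals p m

  drop-vals : ∀ p n → drop p (vals n) ≡ vals (n ∸ p)
  drop-vals zero    n       = refl
  drop-vals (suc p) zero    = refl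
  drop-vals (suc p) (suc n) = drop-vals p n

  -- `stride` has already consumed the head when it drops `g - 1` entries, which makes a full step
  -- of `g`.
  pred-∸ : ∀ n → n ∸ (g ∸ 1) ≡ suc n ∸ g
  pred-∸ n = cong (suc n ∸_) (m+[n∸m]≡n 0<g)

  stride-vals : ∀ f n → stride (g ∸ 1) f (vals n) ≡ ladder f n
  stride-vals zero    n       = refl
  stride-vals (suc f) zero    = refl
  stride-vals (suc f) (suc n) = cong (a (suc n) +_)
    (trans (cong (stride (g ∸ 1) f) (trans (drop-vals (g ∸ 1) n) (cong vals (pred-∸ n)))) (stride-vals f (suc n ∸ g)))

  advance-vals : ∀ j → Rec j → advance (vals (suc (k + j))) ≡ vals (suc (suc (k + j)))
  advance-vals j rec = cong (_∷ vals (suc (k + j)))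
    (trans (cong (a (suc (k + j)) +_) (at-vals′ k j (sym (+-suc k j)))) (sym rec))

  c-1 : ∀ j → j + c ≡ (c ∸ 1) + suc j
  c-1 j = trans (cong (j +_) (sym (m+[n∸m]≡n 0<c))) (solve 2 (λ j c → j :+ (con 1 :+ c) := c :+ (con 1 :+ j)) refl j (c ∸ 1))

  violated-absurd : LadderBound → ∀ j → c < j → j ≤ k + g → violated (vals (j + c)) ≡ true → ⊥
  violated-absurd Y (suc j) c<j j≤ eq = <⇒≱ (Y (suc j) c<j j≤) (subst₂ _≤_
    (cong₂ _+_ (at-vals′ c j (+-comm (suc j) c)) (at-vals′ (c ∸ 1) (suc j) (c-1 (suc j))))
    (trans (stride-vals (k + k) (suc j + c)) (ladder-fuel (k + k) (suc j + c) (suc j + c) (≤-trans (+-monoˡ-≤ c j≤) (≤-reflexive (+-assoc k g c))) ≤-refl))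
    (≤ᵇ-true eq))

  fits⇒Window : ∀ i → 2 ≤ g → fits (vals (suc (k + (g + i + c)))) ≡ true → Window i
  fits⇒Window i 2≤g eq = subst₂ _≤_
    (cong (A (g + i + c) +_) (at-vals′ (g ∸ 2) (k + (c + 2 + i)) e₁))
    (cong₂ _+_ (at-vals′ c (k + (g + i)) (solve 3 (λ g c i → con 1 :+ (g :+ c :+ (g :+ i :+ c)) := c :+ (con 1 :+ (g :+ c :+ (g :+ i)))) refl g c i))
               (at-vals′ (c ∸ 1) (k + suc (g + i)) e₂))
    (≤ᵇ-true eq)
    where
    e₁ : suc (k + (g + i + c)) ≡ g ∸ 2 + suc (k + (c + 2 + i))
    e₁ = trans (cong (λ x → suc (k + (x + i + c))) (sym (m+[n∸m]≡n 2≤g)))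
      (solve 4 (λ k h c i → con 1 :+ (k :+ (con 2 :+ h :+ i :+ c)) := h :+ (con 1 :+ (k :+ (c :+ con 2 :+ i)))) refl k (g ∸ 2) c i)
    e₂ : suc (k + (g + i + c)) ≡ c ∸ 1 + suc (k + suc (g + i))
    e₂ = trans (solve 3 (λ k x c → con 1 :+ (k :+ (x :+ c)) := con 1 :+ (k :+ x) :+ c) refl k (g + i) c)
      (trans (c-1 (suc (k + (g + i)))) (cong (λ x → c ∸ 1 + suc x) (sym (+-suc k (g + i)))))

  -- `advance` yields the true next term only where the recurrence is known, hence the assumption on
  -- `Rec`.
  closing-fits : ∀ m j → closing m (vals (suc (k + j))) ≡ true → ∀ t → t < m →
    (∀ i → j ≤ i → i ≤ j + t → Rec i) → fits (vals (suc (suc (k + (j + t))))) ≡ true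
  closing-fits (suc m) j eq t t<m rec
    with ∧-true (fits (advance (vals (suc (k + j))))) eq | advance-vals j (rec j ≤-refl (m≤m+n j t))
  closing-fits (suc m) j eq zero    t<m rec | now , later | adv =
    subst (λ x → fits (vals (suc (suc (k + x)))) ≡ true) (sym (+-identityʳ j)) (subst (λ x → fits x ≡ true) adv now)
  closing-fits (suc m) j eq (suc t) t<m rec | now , later | adv =
    subst (λ x → fits (vals (suc (suc (k + x)))) ≡ true) (sym (+-suc j t))
      (closing-fits m (suc j) (subst (λ x → closing m x ≡ true) (trans adv (cong (vals ∘ suc) (sym (+-suc k j)))) later) t (s≤s⁻¹ t<m)
        (λ i j<i i≤ → rec i (<⇒≤ j<i) (≤-trans i≤ (≤-reflexive (sym (+-suc j t))))))

  -- What the choice `δ = g - c - 2` requires: a genuine subtraction, and its window of length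
  -- `k + 1`.
  Settled : Set
  Settled = c + 2 ≤ g × (∀ i → i ≤ k → Below (suc (k + (g + i))) → Window i)

  module _ (Y : LadderBound) (R : ∀ j → c ≤ j → j ≤ k + g → Rec j) where

    violated-late : ∀ j → c ≤ j → suc j ≤ k → violated (vals (suc (k + j))) ≡ true → ⊥
    violated-late j c≤j j<k v = violated-absurd Y (suc (g + j)) (s≤s (m≤n⇒m≤o+n g c≤j))
      (linear 0 j<k (solve 3 (λ g c j → con 1 :+ (g :+ j) :+ (g :+ c) :+ con 0 := g :+ c :+ g :+ (con 1 :+ j)) refl g c j))
      (subst (λ x → violated (vals x) ≡ true) (solve 3 (λ g c j → con 1 :+ (g :+ c :+ j) := con 1 :+ (g :+ j) :+ c) refl g c j) v)

    settle-sound : ∀ m j → suc j + m ≡ k → c ≤ j → settle m (vals (suc (k + j))) ≡ true → Settled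
    settle-sound zero j eq c≤j ok with ∨-true (violated (vals (suc (k + j)))) ok
    ... | inj₁ v  = ⊥-elim (violated-late j c≤j (m+n≤o⇒m≤o (suc j) (≤-reflexive eq)) v)
    ... | inj₂ ok′ with ∧-true (c + 2 ≤ᵇ g) ok′
    ...   | c+2≤ᵇg , close = c+2≤g , λ i i≤k b → fits⇒Window i (≤-trans (m≤n+m 2 c) c+2≤g)
              (subst (λ x → fits (vals (suc x)) ≡ true) (index i) (closing-fits (suc k) j close i (s≤s i≤k)
                (λ i′ j≤i′ i′≤ → b i′ (≤-trans c≤j j≤i′) (≤-trans (+-monoʳ-≤ (2 + g) i′≤) (≤-reflexive (index′ i))))))
      where
      c+2≤g : c + 2 ≤ g
      c+2≤g = ≤ᵇ-true c+2≤ᵇg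
      j+1≡k : suc j ≡ k
      j+1≡k = trans (sym (+-identityʳ (suc j))) eq
      index : ∀ i → suc (k + (j + i)) ≡ k + (g + i + c)
      index i = trans (sym (+-suc k (j + i))) (cong (k +_) (trans (cong (_+ i) j+1≡k) (solve 3 (λ g c i → g :+ c :+ i := g :+ i :+ c) refl g c i)))
      index′ : ∀ i → 2 + g + (j + i) ≡ suc (k + (g + i))
      index′ i = trans (solve 3 (λ g j i → con 2 :+ g :+ (j :+ i) := con 1 :+ (con 1 :+ j :+ (g :+ i))) refl g j i) (cong (λ x → suc (x + (g + i))) j+1≡k)
    settle-sound (suc m) j eq c≤j ok with ∨-true (violated (vals (suc (k + j)))) ok
    ... | inj₁ v   = ⊥-elim (violated-late j c≤j (m+n≤o⇒m≤o (suc j) (≤-reflexive eq)) v)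
    ... | inj₂ ok′ = settle-sound m (suc j) (trans (sym (+-suc (suc j) m)) eq) (m≤n⇒m≤1+n c≤j)
            (subst (λ x → settle m x ≡ true) (trans (advance-vals j (R j c≤j j≤)) (cong (vals ∘ suc) (sym (+-suc k j)))) ok′)
      where
      j≤ : j ≤ k + g
      j≤ = ≤-trans (n≤1+n j) (≤-trans (m+n≤o⇒m≤o (suc j) (≤-reflexive eq)) (m≤m+n k g))

    branch-true : ∀ m n xs bs P → branch m n xs bs P ≡ true →
      (n ∉ S → grow m (suc n) xs (true ∷ bs) P ≡ true) × (n ∈ S → grow m (suc n) xs (false ∷ bs) P ≡ true)
    branch-true m n xs bs P eq with n <ᵇ k in lt
    ... | true = let (p , q) = ∧-true (grow m (suc n) xs (true ∷ bs) P) eq in (λ _ → p) , (λ _ → q)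
    ... | false with n ≡ᵇ k in same
    ...   | true  = (λ n∉S → ⊥-elim (n∉S (subst (_∈ S) (sym (≡ᵇ⇒≡ n k (true⇒T same))) k∈S))) , (λ _ → eq)
    ...   | false = (λ _ → eq) , λ n∈S → ⊥-elim (≤-<-⊥ (m≤n⇒m<n∨m≡n (All.lookup S≤k n∈S)))
      where
      ≤-<-⊥ : n < k ⊎ n ≡ k → ⊥
      ≤-<-⊥ (inj₁ n<k) = subst T lt (<⇒<ᵇ n<k)
      ≤-<-⊥ (inj₂ n≡k) = subst T same (≡⇒≡ᵇ n k n≡k)

    -- Follow the branch chosen by the actual `S`: the list stays an initial segment of `a`, and `P`
    -- stays complete and sound. A `violated` flag contradicts `LadderBound`, so the branch must
    -- reach `settle`.
    grow-sound : ∀ m n bs P → suc n + m ≡ suc (k + c) → g ≤ n → Bits (suc n) bs →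
      Complete (suc n) P → Sound (suc n) P → grow m (suc n) (vals (suc n)) bs P ≡ true → Settled
    grow-sound zero n bs P eq g≤n bits complete sound ok =
      settle-sound (g ∸ 1) c end ≤-refl (subst (λ x → settle (g ∸ 1) (vals x) ≡ true) (trans (sym (+-identityʳ (suc n))) eq) ok)
      where
      end : suc c + (g ∸ 1) ≡ k
      end = trans (sym (+-suc c (g ∸ 1))) (trans (cong (c +_) (m+[n∸m]≡n 0<g)) (+-comm c g))
    grow-sound (suc m) n bs P eq g≤n bits complete sound ok with ∨-true (violated (vals (suc n))) ok
    ... | inj₁ v = ⊥-elim (violated-absurd Y (suc n ∸ c) (m+n≤o⇒m≤o∸n (suc c) (s≤s (≤-trans (2c≤g Y) g≤n)))
            (≤-trans (m∸n≤m (suc n) c) (≤-trans n<k+c (+-monoʳ-≤ k (<⇒≤ (c<g Y)))))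
            (subst (λ x → violated (vals x) ≡ true) (sym (m∸n+n≡m (m≤n⇒m≤1+n (≤-trans (<⇒≤ (c<g Y)) g≤n)))) v))
      where
      n<k+c : suc n ≤ k + c
      n<k+c = s≤s⁻¹ (subst (suc (suc n) ≤_) eq (≤-trans (m≤m+n (suc (suc n)) m) (≤-reflexive (sym (+-suc (suc n) m)))))
    ... | inj₂ ok′ with ∧-true (not (member v P′)) ok′
      where
      P′ : List ℕ
      P′ = pairSums (a (suc n)) 1 bs P
      v : ℕ
      v = search (g + c) P′ (suc (a (suc n)))
    ...   | fresh , ok″ = continue (suc n ∈? S)
      where
      N : ℕ
      N = suc n
      P′ : List ℕ
      P′ = pairSums (a N) 1 bs P
      v : ℕ
      v = search (g + c) P′ (suc (a N))
      N≤2g : N ≤ g + g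
      N≤2g = ≤-trans (s≤s⁻¹ (subst (suc N ≤_) eq (≤-trans (m≤m+n (suc N) m) (≤-reflexive (sym (+-suc N m))))))
        (≤-trans (≤-reflexive (+-assoc g c c)) (+-monoʳ-≤ g (2c≤g Y)))
      -- Only pairs with larger index `N` are new; since `N ≤ 2 g`, their smaller index is at most
      -- `g`, where `a` is the identity.
      complete′ : Complete (suc N) P′
      complete′ e (suc t) 1≤e 1≤j e+j< e∉ with m≤n⇒m<n∨m≡n (s≤s⁻¹ e+j<)
      ... | inj₁ lt  = pairSums-keep (a N) 1 bs P (complete e (suc t) 1≤e 1≤j lt e∉)
      ... | inj₂ end = subst₂ (λ x y → x + y ∈ P′) (cong a (sym end)) (sym (a≡id (s≤s z≤n) (short e (suc t) (∉S⇒g≤ 1≤e e∉) end)))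
              (pairSums-complete bits (a N) 1 P e t end (∉S⇒g≤ 1≤e e∉) e∉)
        where
        short : ∀ e j → g ≤ e → e + j ≡ N → j ≤ suc g
        short e j g≤e eq = m≤n⇒m≤1+n (+-cancelˡ-≤ g j g (≤-trans (+-monoˡ-≤ j g≤e) (≤-trans (≤-reflexive eq) N≤2g)))
      sound′ : Sound (suc N) P′
      sound′ p with pairSums-sound bits (a N) 1 P p
      ... | inj₁ q = rep-mono (n≤1+n N) (sound q)
      ... | inj₂ (e , t , end , g≤e , e∉ , refl) = subst₂ (λ x y → Rep (suc x) (a x + y)) end
              (a≡id (s≤s z≤n) (m≤n⇒m≤1+n (+-cancelˡ-≤ g (suc t) g (≤-trans (+-monoˡ-≤ (suc t) g≤e) (≤-trans (≤-reflexive end) N≤2g)))))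
              (rep-pair e (suc t) (≤-trans 0<g g≤e) (s≤s z≤n) e∉)
      next : a (suc N) ≡ v
      next = next-term (s≤s z≤n) N≤2g complete′ sound′ (proj₁ (search-spec (g + c) P′ (suc (a N)))) (member-false fresh)
        (proj₂ (search-spec (g + c) P′ (suc (a N))))
      split : (N ∉ S → grow m (suc N) (vals (suc N)) (true ∷ bs) P′ ≡ true) × (N ∈ S → grow m (suc N) (vals (suc N)) (false ∷ bs) P′ ≡ true)
      split = branch-true m N (vals (suc N)) bs P′ (subst (λ x → branch m N (x ∷ vals N) bs P′ ≡ true) (sym next) ok″)
      continue : _ → Settled
      continue (no  N∉S) = grow-sound m N _ P′ (trans (sym (+-suc N m)) eq) (m≤n⇒m≤1+n g≤n) (allowed N∉S bits) complete′ sound′ (proj₁ split N∉S)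
      continue (yes N∈S) = grow-sound m N _ P′ (trans (sym (+-suc N m)) eq) (m≤n⇒m≤1+n g≤n) (forbidden N∈S bits) complete′ sound′ (proj₂ split N∈S)

    explore-sound : explore ≡ true → Settled
    explore-sound ok = grow-sound (c + c) g (true ∷ []) [] (cong suc (sym (+-assoc g c c))) ≤-refl (allowed g∉S start)
      (λ e j 1≤e 1≤j e+j< e∉ → ⊥-elim (<⇒≱ (≤-trans (m<m+n e 1≤j) (s≤s⁻¹ e+j<)) (∉S⇒g≤ 1≤e e∉)))
      (λ ())
      (subst (λ xs → grow (c + c) (suc g) xs (true ∷ []) [] ≡ true) (initial (suc g) ≤-refl) ok)
      where
      initial : ∀ n → n ≤ suc g → applyDownFrom suc n ≡ vals n
      initial zero    _  = refl
      initial (suc n) n≤ = cong₂ _∷_ (sym (a≡id (s≤s z≤n) n≤)) (initial n (≤-trans (n≤1+n n) n≤))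

    resolved-sound : resolved ≡ true → Settled
    resolved-sound ok with ∨-true affordable ok
    ... | inj₁ afford = let (lt , le) = ∧-true (c + c <ᵇ g) afford
                            2c<g = <ᵇ-true lt in
          ≤-trans (linear 0 0<c (solve 1 (λ c → c :+ con 2 :+ c :+ con 0 := con 1 :+ (c :+ c) :+ con 1) refl c)) 2c<g ,
          window-by-budget Y R 2c<g (≤ᵇ-true le)
    ... | inj₂ ok′ with ∨-true (anyBelow overcrowded (suc c)) ok′
    ...   | inj₂ ex = explore-sound ex
    ...   | inj₁ over with anyBelow-true overcrowded (suc c) over
    ...     | i , i≤c , bad = ⊥-elim (<⇒≱ (crowded Y i (s≤s⁻¹ i≤c)) (≤ᵇ-true bad))

    -- At `i = 0`, `crowded` gives `c (c - 1) / 2 + 3 c + 2 ≤ 2 g + 1 ≤ 14 c + 1`, but `c (c - 1) /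
    -- 2 ≥ 11 c` from `c = 23` on.
    c≤22 : g ≤ 7 * c → c ≤ 22
    c≤22 g≤7c = ≮⇒≥ λ 22<c → let (e , 23+e≡c) = m≤n⇒∃[o]m+o≡n 22<c in impossible e 23+e≡c
      where
      sum-large : ∀ e → 11 * (23 + e) ≤ sumFrom id 1 (22 + e)
      sum-large zero    = ≤-refl
      sum-large (suc e) = ≤-trans (≤-reflexive (solve 1 (λ e → con 11 :* (con 24 :+ e) := con 11 :* (con 23 :+ e) :+ con 11) refl e))
        (+-mono-≤ (sum-large e) (m≤m+n 11 (12 + e)))
      impossible : ∀ e → 23 + e ≡ c → ⊥
      impossible e refl = <⇒≱ (crowded Y 0 z≤n) (linear 0 (+-mono-≤ (+-mono-≤ g≤7c g≤7c) (sum-large e))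
        (solve 3 (λ g e s → g :+ con 0 :+ (g :+ con 1) :+ (con 7 :* (con 23 :+ e) :+ con 7 :* (con 23 :+ e) :+ s) :+ con 0
          := con 1 :+ (s :+ (con 23 :+ e :+ (con 23 :+ e) :+ con 0)) :+ (con 23 :+ e :+ con 0) :+ (g :+ g :+ con 11 :* (con 23 :+ e))) refl g e (sumFrom id 1 (22 + e))))

-- Evaluation of the search on the finitely many pairs.

checked : allBelow rows 22 ≡ true
checked = refl

dense-settled : ∀ {S g c} (sp : Spaced S g c) {a} (lid : IsLID S a) → let open Exploration sp lid in
  LadderBound → (∀ j → c ≤ j → j ≤ k + g → Rec j) → g ≤ 7 * c → Settled
dense-settled {S} {g} {suc c} sp lid Y R g≤7c with m≤n⇒∃[o]m+o≡n (Exploration.2c≤g sp lid Y)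
... | h , 2c+h≡g = Exploration.resolved-sound sp lid Y R
  (subst (λ x → Search.resolved x (suc c) ≡ true) 2c+h≡g
    (allBelow-true (row c) (suc (5 * suc c)) (allBelow-true rows 22 checked (Exploration.c≤22 sp lid Y R g≤7c)) (s≤s h≤)))
  where
  h≤ : h ≤ 5 * suc c
  h≤ = linear 0 (≤-trans (≤-reflexive 2c+h≡g) g≤7c)
    (solve 2 (λ c h → h :+ con 7 :* c :+ con 0 := con 5 :* c :+ (c :+ c :+ h)) refl (suc c) h)
dense-settled {c = zero} sp = ⊥-elim (<-irrefl refl (Spaced.0<c sp))

-- The two cases and the final recurrence.

module Recurrence {S : List ℕ} {g c : ℕ} (sp : Spaced S g c) {a : ℕ → ℕ} (lid : IsLID S a) (d : ℕ) where
  open Exploration sp lid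

  known-gaps : (∀ n → k + c + 1 ≤ n → n ≤ 2 * k + c + d + 2 → a n + a (n ∸ k) > tailSum a g n) →
    ∀ j → c ≤ j → j ≤ k + c + d + 1 → Gap j
  known-gaps iii j c≤j j≤ = subst₂ _<_ (tailSum≡Θ (k + j)) (cong (λ x → a (suc (k + j)) + a x) (trans (cong (_∸ k) (sym (+-suc k j))) (m+n∸m≡n k (suc j))))
    (iii (suc (k + j))
      (linear 0 c≤j (solve 3 (λ k c j → k :+ c :+ con 1 :+ j :+ con 0 := con 1 :+ (k :+ j) :+ c) refl k c j))
      (linear 0 j≤ (solve 4 (λ k c d j → con 1 :+ (k :+ j) :+ (k :+ c :+ d :+ con 1) :+ con 0 := con 2 :* k :+ c :+ d :+ con 2 :+ j) refl k c d j)))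

  all-gaps : 2 * d + 2 ≤ k + 4 * c →
    (∀ n → c + d + 1 ≤ n → n ≤ k + c + 1 + d → a (n + 1) + a n > a (n + c) + a (n ∸ d)) →
    (∀ j → c ≤ j → j ≤ k + c + d + 1 → Gap j) → ∀ j → c ≤ j → Gap j
  all-gaps i ii known with d + c + 2 ≤? g
  -- Hypothesis (ii) at `n = d + r` is a strict form of `X d r`, and its range is exactly the window
  -- starting at `c + 1`.
  ... | yes d≤ = propagate d (suc c) (k + c + d + 1) d≤ ≤-refl ≤-refl
          (by-slack (suc k) (solve 3 (λ k c d → d :+ (con 1 :+ c) :+ (con 1 :+ k) := con 1 :+ (k :+ c :+ d :+ con 1)) refl k c d))
          window known
    where
    window : ∀ r → suc c ≤ r → r ≤ suc c + k → Below (d + r) → X d r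
    window r c<r r≤ _ = <⇒≤ (subst₂ _<_ (cong (λ x → a (d + r + c) + a x) (m+n∸m≡n d r))
      (trans (+-comm (a (d + r + 1)) _) (cong (λ x → a (d + r) + a x) (+-comm (d + r) 1)))
      (ii (d + r)
        (linear 0 c<r (solve 3 (λ c d r → c :+ d :+ con 1 :+ r :+ con 0 := d :+ r :+ (con 1 :+ c)) refl c d r))
        (linear 0 r≤ (solve 4 (λ k c d r → d :+ r :+ (con 1 :+ c :+ k) :+ con 0 := k :+ c :+ con 1 :+ d :+ r) refl k c d r))))
  -- Only the part of (iii) up to `J = k + g` is used; the window starts where `δ + r = J + 1`.
  ... | no d≰ = propagate δ (k + c + 3) (k + g) (≤-reflexive δ+c+2)
          (by-slack (k + 2) (solve 2 (λ k c → con 1 :+ c :+ (k :+ con 2) := k :+ c :+ con 3) refl k c))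
          (linear 1 (≤-reflexive δ+c+2) (solve 4 (λ k g c δ → k :+ c :+ δ :+ con 1 :+ g :+ con 1 := k :+ g :+ (δ :+ c :+ con 2)) refl k g c δ))
          (linear 0 (≤-reflexive δ+c+2) (solve 4 (λ k g c δ → δ :+ (k :+ c :+ con 3) :+ g :+ con 0 := con 1 :+ (k :+ g) :+ (δ :+ c :+ con 2)) refl k g c δ))
          window (λ j c≤j j≤ → known j c≤j (≤-trans j≤ J≤))
    where
    g≤ : g ≤ d + c + 1
    g≤ = s≤s⁻¹ (≤-trans (≰⇒> d≰) (≤-reflexive (+-suc (d + c) 1)))
    J≤ : k + g ≤ k + c + d + 1
    J≤ = linear 0 g≤ (solve 4 (λ k g c d → k :+ g :+ (d :+ c :+ con 1) :+ con 0 := k :+ c :+ d :+ con 1 :+ g) refl k g c d)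
    R : ∀ j → c ≤ j → j ≤ k + g → Rec j
    R j c≤j j≤ = gap⇒rec (known j c≤j (≤-trans j≤ J≤))
    Y : LadderBound
    Y (suc j) c<j j≤ = gap⇒ladder (R j (s≤s⁻¹ c<j) (≤-trans (n≤1+n j) j≤)) (known (suc j) (<⇒≤ c<j) (≤-trans j≤ J≤))
    -- Hypothesis (i) and `g ≤ d + c + 1` give `2 g ≤ 2 d + 2 c + 2 ≤ g + 7 c`.
    settled : Settled
    settled = dense-settled sp lid Y R (linear 0 (+-mono-≤ i (+-mono-≤ g≤ g≤))
      (solve 3 (λ g c d → g :+ (g :+ c :+ con 4 :* c :+ (d :+ c :+ con 1 :+ (d :+ c :+ con 1))) :+ con 0 := con 7 :* c :+ (con 2 :* d :+ con 2 :+ (g :+ g))) refl g c d))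
    δ : ℕ
    δ = g ∸ (c + 2)
    δ+c+2 : δ + c + 2 ≡ g
    δ+c+2 = trans (+-assoc δ c 2) (m∸n+n≡m (proj₁ settled))
    window : ∀ r → k + c + 3 ≤ r → r ≤ k + c + 3 + k → Below (δ + r) → X δ r
    window r w≤r r≤ b with m≤n⇒∃[o]m+o≡n w≤r
    ... | i , refl = subst₂ _≤_ (cong₂ (λ x y → a x + a y) (trans (cong suc (sym (+-assoc k (g + i) c))) (cong (_+ c) (sym top)))
                       (solve 3 (λ k c i → con 1 :+ (k :+ (c :+ con 2 :+ i)) := k :+ c :+ con 3 :+ i) refl k c i))
                     (cong₂ (λ x y → a x + a y) (sym top) (trans (cong suc (+-suc k (g + i))) (cong suc (sym top))))
                     (proj₂ settled i (+-cancelˡ-≤ (k + c + 3) i k r≤) (subst Below top b))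
      where
      top : δ + (k + c + 3 + i) ≡ suc (k + (g + i))
      top = trans (solve 4 (λ δ k c i → δ :+ (k :+ c :+ con 3 :+ i) := con 1 :+ (k :+ (δ :+ c :+ con 2 :+ i))) refl δ k c i)
              (cong (λ x → suc (k + (x + i))) δ+c+2)

  recurrence : 2 * d + 2 ≤ k + 4 * c →
    (∀ n → c + d + 1 ≤ n → n ≤ k + c + 1 + d → a (n + 1) + a n > a (n + c) + a (n ∸ d)) →
    (∀ n → k + c + 1 ≤ n → n ≤ 2 * k + c + d + 2 → a n + a (n ∸ k) > tailSum a g n) →
    ∀ n → k + c < n → a (n + 1) ≡ a n + a (n ∸ k)
  recurrence i ii iii n k+c<n with m≤n⇒∃[o]m+o≡n k+c<n
  ... | o , refl = rec-at (c + o) (gap⇒rec (all-gaps i ii (known-gaps iii) (c + o) (m≤m+n c o)))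
          (trans (cong (2 +_) (sym (+-assoc k c o))) (+-comm 1 (suc (k + c) + o)))
          (cong suc (sym (+-assoc k c o)))
          (sym (trans (cong (_∸ k) (trans (cong suc (+-assoc k c o)) (sym (+-suc k (c + o))))) (m+n∸m≡n k (suc (c + o)))))

theorem3p6 : (S : List ℕ) → All (λ s → 1 ≤ s) S →
    (k : ℕ) → k ∈ S → All (λ s → s ≤ k) S →
    (c : ℕ) → 0 < c → c < k → (k ∸ c) ∉ S →
    (∀ m → 1 ≤ m → m < k ∸ c → m ∈ S) →
    (a : ℕ → ℕ) → IsLID S a →
    (d : ℕ) → 0 < d →
    2 * d + 2 ≤ k + 4 * c →
    (∀ n → c + d + 1 ≤ n → n ≤ k + c + 1 + d →
    a (n + 1) + a n > a (n + c) + a (n ∸ d)) →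
    (∀ n → k + c + 1 ≤ n → n ≤ 2 * k + c + d + 2 →
    a n + a (n ∸ k) > tailSum a (k ∸ c) n) →
    ∀ n → k + c < n → a (n + 1) ≡ a n + a (n ∸ k)
theorem3p6 S pos k k∈S S≤k c 0<c c<k g∉S below a lid d _ =
  shifted (k ∸ c) k (m∸n+n≡m (<⇒≤ c<k)) (m<n⇒0<n∸m c<k) k∈S S≤k g∉S below
  where
  -- Abstracting `k ∸ c` to `g` with `g + c ≡ k` allows `k` to be replaced by `g + c` through
  -- matching on `refl`.
  shifted : ∀ g k → g + c ≡ k → 0 < g → k ∈ S → All (λ s → s ≤ k) S → g ∉ S → (∀ m → 1 ≤ m → m < g → m ∈ S) →
    2 * d + 2 ≤ k + 4 * c →
    (∀ n → c + d + 1 ≤ n → n ≤ k + c + 1 + d → a (n + 1) + a n > a (n + c) + a (n ∸ d)) →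
    (∀ n → k + c + 1 ≤ n → n ≤ 2 * k + c + d + 2 → a n + a (n ∸ k) > tailSum a g n) →
    ∀ n → k + c < n → a (n + 1) ≡ a n + a (n ∸ k)
  shifted g _ refl 0<g k∈S S≤k g∉S below = Recurrence.recurrence spaced lid d
    where
    spaced : Spaced S g c
    spaced = record { 0<g = 0<g ; 0<c = 0<c ; pos = pos ; k∈S = k∈S ; S≤k = S≤k ; g∉S = g∉S ; below = below }
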